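{- For any connected simple graph $G$ on $[N]$, $\mathrm{NVol}(\nabla^{\mathrm{PQ}}_G)=|\mathfrak{D}(G)|$.
   Context: For a simple graph $G$ on vertex set $[N]=\{1,\dots,N\}$, the PQ-type adjacency polytope is $\nabla^{\mathrm{PQ}}_G=\mathrm{conv}\{(e_i,e_j)\in\mathbb{R}^{2N} : ij\in E(G)\text{ or } i=j\}$, where $e_1,\dots,e_N$ are the standard basis vectors of $\mathbb{R}^N$. For a lattice polytope $P$, $\mathrm{NVol}(P)=(\dim P)!\,\mathrm{vol}(P)$, with $\mathrm{vol}$ the relative volume. Let $\mathcal{N}_G(i)$ denote the set of neighbors of $i$ in $G$. A sequence $(a_1,\dots,a_N)\in\mathbb{Z}_{\ge 0}^N$ is called $D(G)$-draconian if $\sum_i a_i=N-1$ and for every nonempty $S\subseteq[N]$, $\sum_{i\in S}a_i < \left|S\cup\bigcup_{i\in S}\mathcal{N}_G(i)\right|$. $\mathfrak{D}(G)$ denotes the set of $D(G)$-draconian sequences. -}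

module Defs where

open import Data.Nat as ℕ using (ℕ; zero; suc; _∸_; _≤_; _<_)
open import Data.Nat.Base using (_!)
open import Data.Integer as ℤ using (ℤ; +_)
open import Data.Bool using (Bool; true; false; _∧_; _∨_; if_then_else_)
open import Data.Fin using (Fin; _≟_)
open import Data.Fin.Subset using (Subset; Nonempty) renaming (∣_∣ to card)
open import Data.Vec as Vec using (Vec; []; _∷_; tabulate; lookup; _++_; replicate; zipWith; foldr)
open import Data.List as List using (List; length; concatMap; allFin; filter)
open import Data.List.Membership.Propositional using (_∈_)
open import Data.List.Relation.Unary.Unique.Propositional using (Unique)
open import Data.Product using (Σ; _×_; _,_)
open import Relation.Binary.PropositionalEquality using (_≡_)
open import Relation.Binary.Construct.Closure.ReflexiveTransitive using (Star)
open import Relation.Nullary.Decidable using (⌊_⌋)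
open import Function.Bundles using (_⇔_)

record SimpleGraph (N : ℕ) : Set where
  field
    adj    : Fin N → Fin N → Bool
    sym    : ∀ i j → adj i j ≡ adj j i
    irrefl : ∀ i → adj i i ≡ false
open SimpleGraph public

Edge : ∀ {N} → SimpleGraph N → Fin N → Fin N → Set
Edge G i j = adj G i j ≡ true

Connected : ∀ {N} → SimpleGraph N → Set
Connected {N} G = ∀ (i j : Fin N) → Star (Edge G) i j

sumℕ : ∀ {n} → Vec ℕ n → ℕ
sumℕ = foldr _ ℕ._+_ 0

sumOver : ∀ {N} → Subset N → Vec ℕ N → ℕ
sumOver S a = sumℕ (zipWith (λ b x → if b then x else 0) S a)

anyV : ∀ {n} → Vec Bool n → Bool
anyV = foldr _ _∨_ false

closedNbhd : ∀ {N} → SimpleGraph N → Subset N → Subset N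
closedNbhd G S = tabulate λ j →
  anyV (tabulate λ i → lookup S i ∧ (⌊ i ≟ j ⌋ ∨ adj G i j))

Draconian : ∀ {N} → SimpleGraph N → Vec ℕ N → Set
Draconian {N} G a =
  (sumℕ a ≡ N ∸ 1) ×
  (∀ (S : Subset N) → Nonempty S → sumOver S a < card (closedNbhd G S))

EnumeratesDraconian : ∀ {N} → SimpleGraph N → List (Vec ℕ N) → Set
EnumeratesDraconian G L = Unique L × (∀ a → (a ∈ L) ⇔ Draconian G a)

-- Lattice polytopes P = conv(V), V a finite list of points of ℤ^M

Pt : ℕ → Set
Pt M = Vec ℤ M

sumℤ : ∀ {n} → Vec ℤ n → ℤ
sumℤ = foldr _ ℤ._+_ (+ 0)

scale : ∀ {M} → ℤ → Pt M → Pt M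
scale c = Vec.map (c ℤ.*_)

zcomb : ∀ {M} (V : List (Pt M)) → Vec ℤ (length V) → Pt M
zcomb {M} List.[] [] = replicate M (+ 0)
zcomb (v List.∷ V) (c ∷ cs) = zipWith ℤ._+_ (scale c v) (zcomb V cs)

-- x ∈ t·conv(V) for x ∈ ℤ^M: x = Σ λ_k v_k with rational λ_k ≥ 0, Σ λ_k = t;
-- clearing denominators (m ≥ 1): m x = Σ μ_k v_k, μ_k ∈ ℕ, Σ μ_k = m t.
InDilate : ∀ {M} → List (Pt M) → ℕ → Pt M → Set
InDilate V t x =
  Σ ℕ λ m → Σ (Vec ℕ (length V)) λ μ →
    (1 ≤ m) × (sumℕ μ ≡ m ℕ.* t) ×
    (zcomb V (Vec.map +_ μ) ≡ scale (+ m) x)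

LatticeCount : ∀ {M} → List (Pt M) → ℕ → ℕ → Set
LatticeCount {M} V t k =
  Σ (List (Pt M)) λ L → Unique L × (length L ≡ k) ×
    (∀ x → (x ∈ L) ⇔ InDilate V t x)

_⊆_ : ∀ {M} → List (Pt M) → List (Pt M) → Set
ps ⊆ V = ∀ {x} → x ∈ ps → x ∈ V

-- affine independence (over ℚ, equivalently over ℤ)
AffInd : ∀ {M} → List (Pt M) → Set
AffInd {M} ps = ∀ (c : Vec ℤ (length ps)) → sumℤ c ≡ + 0 →
  zcomb ps c ≡ replicate M (+ 0) → c ≡ replicate _ (+ 0)

IsDim : ∀ {M} → List (Pt M) → ℕ → Set
IsDim V d =
  (Σ _ λ ps → ps ⊆ V × (length ps ≡ suc d) × AffInd ps) ×
  (∀ ps → ps ⊆ V → AffInd ps → length ps ≤ suc d)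

-- NVol(conv V) = v : with d = dim, (dim)!·vol = v where the relative volume
-- is  lim_{t→∞} |tP ∩ ℤ^M| / t^d.  The limit is written with ε = 1/(e+1):
-- |d!·L(t) − v·t^d| · (e+1) ≤ t^d for all t ≥ T.
NVol : ∀ {M} → List (Pt M) → ℕ → Set
NVol V v =
  Σ ℕ λ d → IsDim V d ×
  Σ (ℕ → ℕ) λ L → (∀ t → LatticeCount V t (L t)) ×
  (∀ (e : ℕ) → Σ ℕ λ T → ∀ t → T ≤ t →
     ℤ.∣ (+ ((d !) ℕ.* L t)) ℤ.- (+ (v ℕ.* (t ℕ.^ d))) ∣ ℕ.* suc e ≤ t ℕ.^ d)

unitVec : ∀ {N} → Fin N → Pt N
unitVec i = tabulate λ k → if ⌊ k ≟ i ⌋ then + 1 else + 0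

PQVerts : ∀ {N} → SimpleGraph N → List (Pt (N ℕ.+ N))
PQVerts {N} G = concatMap (λ i → concatMap (λ j →
    if ⌊ i ≟ j ⌋ ∨ adj G i j then List.[ unitVec i ++ unitVec j ] else List.[])
  (allFin N)) (allFin N)

{-# OPTIONS --safe #-}

-- The vertices (e_i , e_j) of the polytope are the arcs (i , j) of the bipartite graph D(G), so a lattice point
-- of its t-th dilate is a pair (row sums, column sums) of a nonnegative integer matrix supported on D(G) with
-- total t (a transportation problem; integrality comes from a greedy proof of Gale's supply-demand theorem).
-- The greedy solution is the lexicographically largest one; call such matrices good. Each lattice point has
-- exactly one good matrix, goodness depends only on the support, and the support of a good matrix is a forest:
-- the good supports are the faces of a unimodular triangulation. Hence |tP ∩ ℤ^M| is the sum over good supports F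
-- of the number of positive weightings of F with sum t, and asymptotically only the good spanning trees, with
-- 2N - 1 arcs, contribute, each t^(2N-2) / (2N-2)!.
--
-- A spanning tree F has the draconian sequence a = (row degrees of F) - 1. For each l the tree carries a unique
-- matrix with row sums a + e_l and column sums 1, which uses every arc at row l; by uniqueness of good matrices
-- these matrices, hence a, determine F. Conversely, for a draconian sequence a, the support of the good matrix
-- with row sums N a + 1 and column sums N is such a tree.
module Submission where

open import Defs hiding (sym; _⊆_)
open import Data.Nat using (ℕ; _≤_)
open import Data.Vec using (Vec)
open import Data.List using (List; length)
open import Data.Product using (Σ; _×_)

open import Data.Bool using (Bool; true; false; if_then_else_; _∧_; _∨_; f≤t; b≤b) renaming (_≤_ to _≤ᴮ_)
import Data.Bool.Properties as BoolP
open import Data.Empty using (⊥-elim)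
open import Data.Fin as Fin using (Fin; zero; suc)
import Data.Fin.Properties as FinP
open import Data.Fin.Subset using (Subset; ⊤; ⊥; ∁; _∪_; _∩_; ⁅_⁆) renaming (∣_∣ to card; _-_ to _without_)
open import Data.Fin.Subset.Properties using (anySubset?; p∪∁p≡⊤; ∩-inverseʳ; x∈p⇒∣p-x∣<∣p∣; x∈p∧x≢y⇒x∈p-y; ∣⊤∣≡n; ∣p∣≤n; ∈⊤; p⊆q⇒∣p∣≤∣q∣; ∣⁅x⁆∣≡1)
open import Data.Integer as ℤ using (ℤ; +_; -[1+_]; -_; _+_; _*_; _<_; _-_; +≤+; +<+) renaming (_≤_ to _≤ᶻ_)
import Data.Integer.Properties as ℤP
open import Data.Integer.Tactic.RingSolver using (solve-∀)
open import Data.List as List using ([]; _∷_; filter; filterᵇ; map; concatMap; allFin; _++_)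
open import Data.List.Membership.Propositional using (_∈_; find; lose)
open import Data.List.Membership.Propositional.Properties
import Data.List.Properties as ListP
open import Data.List.Relation.Binary.Disjoint.Propositional using (Disjoint)
open import Data.List.Relation.Binary.Sublist.Propositional using ([]; _∷ʳ_; _∷_) renaming (_⊆_ to _⊑_)
open import Data.List.Relation.Unary.All as All using (All; []; _∷_)
import Data.List.Relation.Unary.All.Properties as AllP
open import Data.List.Relation.Unary.AllPairs as AllPairs using ([]; _∷_)
import Data.List.Relation.Unary.AllPairs.Properties as AllPairsP
open import Data.List.Relation.Unary.Any using (here; there)
open import Data.List.Relation.Unary.Unique.Propositional using (Unique)
import Data.List.Relation.Unary.Unique.Propositional.Properties as UniqueP
open import Data.Nat as ℕ using (zero; suc; s≤s; z≤n; _!)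
import Data.Nat.Properties as ℕP
open import Algebra.Properties.CommutativeSemigroup ℕP.+-commutativeSemigroup using (x∙yz≈y∙xz)
open import Data.Nat.Properties using (_!≢0)
open import Data.Nat.Tactic.RingSolver renaming (solve-∀ to solveℕ)
open import Data.Product using (_,_; proj₁; proj₂; ∃; ∃₂)
open import Data.Sum using (_⊎_; inj₁; inj₂)
open import Data.Vec as Vec using ([]; _∷_; lookup; replicate; zipWith; updateAt; cast; tabulate)
import Data.Vec.Properties as VecP
open import Function.Bundles using (_⇔_; mk⇔; Equivalence)
open import Relation.Binary using (tri<; tri≈; tri>)
open import Relation.Binary.Construct.Closure.ReflexiveTransitive using (Star; ε; _◅_)
open import Relation.Binary.PropositionalEquality using (_≡_; _≢_; refl; sym; trans; cong; cong₂; subst; subst₂)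
open import Relation.Nullary using (¬_; Dec; yes; no; does; _×-dec_; contradiction)
open import Relation.Nullary.Decidable using (⌊_⌋; map′; dec-true; dec-false)

-- Margins are handled through cuts: a row set S and a column set B get the value "column sums over
-- B minus row sums over S". Removing copies of an arc, tightness and uncrossing then concern a
-- single modular set function, and Gale's condition is its nonnegativity on the pairs where every
-- arc starting in S ends in B. Taking an entry as large as possible produces a tight cut, and this
-- cut serves twice: uncrossing with it keeps the remainder feasible, and it certifies that no
-- circulation can raise the entry.
--
-- The correspondence between trees and sequences rests on one bound: a forest with all its arcs in
-- S × B has fewer than |S| + |B| arcs. For the tree arcs leaving S this is the draconian
-- inequality. For the whole graph it caps every good support at 2N - 1 arcs, and for a draconian
-- sequence the matrices with row sums a + e_l and column sums 1 force that many. The point with row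
-- sums N a + 1 is used because Gale's condition for it is equivalent to the draconian inequalities,
-- so the support of its good matrix inherits them.

private variable
  n k m : ℕ
  A B : Set

-- Cuts, circulations and lexicographic maximality

Arc : ℕ → Set
Arc n = Fin n × Fin n

ι : Bool → ℤ
ι true  = + 1
ι false = + 0

gain : Arc n → Subset n → Subset n → ℤ
gain (i , j) S B = ι (lookup B j) - ι (lookup S i)

-- The total gain is the excess of the column sums over B above the row sums over S.
val : (es : List (Arc n)) → Vec ℤ (length es) → Subset n → Subset n → ℤ
val []       []      S B = + 0
val (e ∷ es) (z ∷ zs) S B = z * gain e S B + val es zs S B

record Respects (S B : Subset n) (e : Arc n) : Set where
  constructor respects
  field ordered : lookup S (proj₁ e) ≤ᴮ lookup B (proj₂ e)

-- `B` contains all neighbours of `S`. On such cuts no arc has negative gain, so every nonnegative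
-- weighting has nonnegative value there.
Closed : List (Arc n) → Subset n → Subset n → Set
Closed es S B = All (Respects S B) es

closed? : (es : List (Arc n)) (S B : Subset n) → Dec (Closed es S B)
closed? es S B = All.all? (λ (i , j) → map′ respects Respects.ordered (lookup S i BoolP.≤? lookup B j)) es

-- Equivalent to vanishing row and column sums (`circ⇒margins`, `margins⇒circ`); the cut form is the
-- one that meets the tight cuts directly.
Circ : (es : List (Arc n)) → Vec ℤ (length es) → Set
Circ es z = ∀ S B → val es z S B ≡ + 0

data LexPos : ∀ {k} → Vec ℤ k → Set where
  here  : ∀ {k x} {xs : Vec ℤ k} → + 0 < x → LexPos (x ∷ xs)
  there : ∀ {k x} {xs : Vec ℤ k} → x ≡ + 0 → LexPos xs → LexPos (x ∷ xs)

-- The directions `z` for which m W + z is nonnegative for some large m. Only the zero entries of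
-- `W` restrict signs, which is why goodness depends on the support alone.
data Admissible : ∀ {k} → Vec ℕ k → Vec ℤ k → Set where
  []  : Admissible [] []
  _∷_ : ∀ {k w z} {ws : Vec ℕ k} {zs : Vec ℤ k} → (w ≡ 0 → + 0 ≤ᶻ z) →
        Admissible ws zs → Admissible (w ∷ ws) (z ∷ zs)

-- No lexicographically positive circulation can be added to (a multiple of) W:
-- W is lexicographically maximal among the nonnegative matrices with its margins.
Good : (es : List (Arc n)) → Vec ℕ (length es) → Set
Good es W = ∀ z → Circ es z → Admissible W z → ¬ LexPos z

toℤ : ∀ {k} → Vec ℕ k → Vec ℤ k
toℤ = Vec.map (+_)

0≤+ : ∀ {x y} → + 0 ≤ᶻ x → + 0 ≤ᶻ y → + 0 ≤ᶻ x + y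
0≤+ = ℤP.+-mono-≤

0≤* : ∀ {x y} → + 0 ≤ᶻ x → + 0 ≤ᶻ y → + 0 ≤ᶻ x * y
0≤* {+ a} {+ b} _ _ = subst (+ 0 ≤ᶻ_) (ℤP.pos-* a b) (+≤+ ℕ.z≤n)

0≤ : ∀ {a} → + 0 ≤ᶻ + a
0≤ = +≤+ ℕ.z≤n

sum-zero : ∀ {x y} → + 0 ≤ᶻ x → + 0 ≤ᶻ y → x + y ≡ + 0 → x ≡ + 0 × y ≡ + 0
sum-zero {x} {y} p q eq = ℤP.≤-antisym (subst (x ≤ᶻ_) eq (ℤP.≤-trans (ℤP.≤-reflexive (sym (ℤP.+-identityʳ x))) (ℤP.+-monoʳ-≤ x q))) p
                        , ℤP.≤-antisym (subst (y ≤ᶻ_) eq (ℤP.≤-trans (ℤP.≤-reflexive (sym (ℤP.+-identityˡ y))) (ℤP.+-monoˡ-≤ y p))) q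

0≤gain : ∀ (e : Arc n) S B → Respects S B e → + 0 ≤ᶻ gain e S B
0≤gain (i , j) S B (respects r) with lookup S i | lookup B j | r
... | true  | true  | _ = 0≤
... | false | true  | _ = 0≤
... | false | false | _ = 0≤

0≤val : ∀ (es : List (Arc n)) W S B → Closed es S B → + 0 ≤ᶻ val es (toℤ W) S B
0≤val []       []      S B []       = 0≤
0≤val (e ∷ es) (w ∷ W) S B (r ∷ rs) = 0≤+ (0≤* (0≤ {w}) (0≤gain e S B r)) (0≤val es W S B rs)

∪-lookup : ∀ (S T : Subset n) i → lookup (S ∪ T) i ≡ lookup S i ∨ lookup T i
∪-lookup S T i = VecP.lookup-zipWith _∨_ i S T

∩-lookup : ∀ (S T : Subset n) i → lookup (S ∩ T) i ≡ lookup S i ∧ lookup T i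
∩-lookup S T i = VecP.lookup-zipWith _∧_ i S T

∨-mono : ∀ {a b c d} → a ≤ᴮ b → c ≤ᴮ d → (a ∨ c) ≤ᴮ (b ∨ d)
∨-mono {true} {true} _ _ = b≤b
∨-mono {false} {false} _ q = q
∨-mono {false} {true} {false} _ q = f≤t
∨-mono {false} {true} {true} _ q = b≤b

∧-mono : ∀ {a b c d} → a ≤ᴮ b → c ≤ᴮ d → (a ∧ c) ≤ᴮ (b ∧ d)
∧-mono {true} {true} _ q = q
∧-mono {false} {false} _ q = b≤b
∧-mono {false} {true} {d = false} _ q = b≤b
∧-mono {false} {true} {d = true} _ q = f≤t

closed-∪ : ∀ {es : List (Arc n)} {S B S′ B′} → Closed es S B → Closed es S′ B′ → Closed es (S ∪ S′) (B ∪ B′)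
closed-∪ [] [] = []
closed-∪ {es = (i , j) ∷ _} {S} {B} {S′} {B′} (respects p ∷ ps) (respects q ∷ qs) =
  respects (subst₂ _≤ᴮ_ (sym (∪-lookup S S′ i)) (sym (∪-lookup B B′ j)) (∨-mono p q)) ∷ closed-∪ ps qs

closed-∩ : ∀ {es : List (Arc n)} {S B S′ B′} → Closed es S B → Closed es S′ B′ → Closed es (S ∩ S′) (B ∩ B′)
closed-∩ [] [] = []
closed-∩ {es = (i , j) ∷ _} {S} {B} {S′} {B′} (respects p ∷ ps) (respects q ∷ qs) =
  respects (subst₂ _≤ᴮ_ (sym (∩-lookup S S′ i)) (sym (∩-lookup B B′ j)) (∧-mono p q)) ∷ closed-∩ ps qs

-- Gale's theorem by greedy removal of arcs

SetFun : ℕ → Set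
SetFun n = Subset n → Subset n → ℤ

Modular : SetFun n → Set
Modular b = ∀ S B S′ B′ → b S B + b S′ B′ ≡ b (S ∪ S′) (B ∪ B′) + b (S ∩ S′) (B ∩ B′)

-- Gale's condition, stated for a modular set function rather than for margins, so that subtracting
-- copies of an arc stays within the same class.
record Feasible (es : List (Arc n)) (b : SetFun n) : Set where
  field
    modular : Modular b
    empty   : b ⊥ ⊥ ≡ + 0
    full    : b ⊤ ⊤ ≡ + 0
    nonneg  : ∀ S B → Closed es S B → + 0 ≤ᶻ b S B

ι-modular : ∀ a c → ι a + ι c ≡ ι (a ∨ c) + ι (a ∧ c)
ι-modular true  true  = refl
ι-modular true  false = refl
ι-modular false true  = refl
ι-modular false false = refl

gain-modular : ∀ (e : Arc n) → Modular (gain e)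
gain-modular (i , j) S B S′ B′
  rewrite ∪-lookup S S′ i | ∩-lookup S S′ i | ∪-lookup B B′ j | ∩-lookup B B′ j =
  trans (rearr (ι (lookup B j)) (ι (lookup S i)) (ι (lookup B′ j)) (ι (lookup S′ i)))
    (trans (cong₂ _-_ (ι-modular (lookup B j) (lookup B′ j)) (ι-modular (lookup S i) (lookup S′ i)))
      (rearr′ (ι (lookup B j ∨ lookup B′ j)) (ι (lookup B j ∧ lookup B′ j)) (ι (lookup S i ∨ lookup S′ i)) (ι (lookup S i ∧ lookup S′ i))))
  where
  rearr : ∀ a b c d → (a - b) + (c - d) ≡ (a + c) - (b + d)
  rearr = solve-∀
  rearr′ : ∀ a c b d → (a + c) - (b + d) ≡ (a - b) + (c - d)
  rearr′ = solve-∀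

remove-modular : ∀ (b : SetFun n) (e : Arc n) w → Modular b → Modular (λ S B → b S B - w * gain e S B)
remove-modular b e w m S B S′ B′ =
  trans (lem (b S B) (b S′ B′) w (gain e S B) (gain e S′ B′))
    (trans (cong₂ (λ x y → x - w * y) (m S B S′ B′) (gain-modular e S B S′ B′))
      (lem′ (b (S ∪ S′) (B ∪ B′)) (b (S ∩ S′) (B ∩ B′)) w (gain e (S ∪ S′) (B ∪ B′)) (gain e (S ∩ S′) (B ∩ B′))))
  where
  lem : ∀ a b w c d → (a - w * c) + (b - w * d) ≡ (a + b) - w * (c + d)
  lem = solve-∀
  lem′ : ∀ a b w c d → (a + b) - w * (c + d) ≡ (a - w * c) + (b - w * d)
  lem′ = solve-∀

-- A cut with gain 1 at `e` loses one unit per removed copy; if its value is below `w`, then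
-- removing `w` copies would make it negative.
Blocks : List (Arc n) → SetFun n → Arc n → ℕ → Subset n × Subset n → Set
Blocks es b (i , j) w (S , B) = Closed es S B × lookup S i ≡ false × lookup B j ≡ true × b S B < + w

blocks? : (es : List (Arc n)) (b : SetFun n) (e : Arc n) (w : ℕ) → Dec (∃₂ λ S B → Blocks es b e w (S , B))
blocks? es b (i , j) w = anySubset? λ S → anySubset? λ B →
  closed? es S B ×-dec (lookup S i BoolP.≟ false) ×-dec (lookup B j BoolP.≟ true) ×-dec (b S B ℤP.<? + w)

-- w copies of the arc e can be removed without making the closed pairs of es infeasible, but not w + 1.
record Maximal (es : List (Arc n)) (b : SetFun n) (e : Arc n) : Set where
  field
    w       : ℕ
    fits    : ∀ S B → ¬ Blocks es b e w (S , B)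
    S₀ B₀   : Subset n
    blocked : Blocks es b e (suc w) (S₀ , B₀)

maximal : ∀ (es : List (Arc n)) (b : SetFun n) e w → (∀ S B → ¬ Blocks es b e 0 (S , B)) →
          (∃₂ λ S B → Blocks es b e (suc w) (S , B)) → Maximal es b e
maximal es b e w none (S , B , bl) with blocks? es b e w
maximal es b e zero    none (S , B , bl) | _      = record { w = 0 ; fits = none ; blocked = bl }
maximal es b e (suc w) none _            | yes bl = maximal es b e w none bl
maximal es b e (suc w) none (S , B , bl) | no ¬bl =
  record { w = suc w ; fits = λ S B x → ¬bl (S , B , x) ; blocked = bl }

lookup-⁅⁆ : ∀ (i : Fin n) → lookup ⁅ i ⁆ i ≡ true
lookup-⁅⁆ zero    = refl
lookup-⁅⁆ (suc i) = lookup-⁅⁆ i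

closed-⊥ : ∀ (es : List (Arc n)) B → Closed es ⊥ B
closed-⊥ []             B = []
closed-⊥ ((i , j) ∷ es) B =
  respects (subst (_≤ᴮ lookup B j) (sym (VecP.lookup-replicate i false)) (BoolP.≤-minimum _)) ∷ closed-⊥ es B

maximalExists : ∀ {e} {es : List (Arc n)} {b} → Feasible (e ∷ es) b → Maximal es b e
maximalExists {e = e@(i , j)} {es} {b} F =
  -- The downward search starts at the demand of column `j`: the cut consisting of this column alone
  -- blocks any larger number of copies.
  maximal es b e ℤ.∣ b ⊥ ⁅ j ⁆ ∣ none
    (⊥ , ⁅ j ⁆ , closed-⊥ es _ , VecP.lookup-replicate i false , lookup-⁅⁆ j ,
     subst (_< + suc ℤ.∣ b ⊥ ⁅ j ⁆ ∣) (ℤP.0≤i⇒+∣i∣≡i (nonneg ⊥ ⁅ j ⁆ (closed-⊥ _ _))) (+<+ (ℕP.n<1+n _)))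
  where
  open Feasible F
  none : ∀ S B → ¬ Blocks es b e 0 (S , B)
  none S B (c , p , q , lt) = ℤP.<⇒≱ lt (nonneg S B (respects (subst₂ _≤ᴮ_ (sym p) (sym q) f≤t) ∷ c))

-- Without arcs every pair is closed, so a cut and its complement are both nonnegative; by
-- modularity they sum to `b ⊤ ⊤ + b ⊥ ⊥`, which is 0.
zeroOfFull : ∀ {b : SetFun n} → Feasible [] b → ∀ S B → b S B ≡ + 0
zeroOfFull {b = b} F S B = proj₁ (sum-zero (nonneg S B []) (nonneg (∁ S) (∁ B) []) eq)
  where
  open Feasible F
  eq : b S B + b (∁ S) (∁ B) ≡ + 0
  eq = trans (modular S B (∁ S) (∁ B))
    (trans (cong₂ _+_ (cong₂ b (p∪∁p≡⊤ S) (p∪∁p≡⊤ B)) (cong₂ b (∩-inverseʳ S) (∩-inverseʳ B)))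
      (cong₂ _+_ full empty))

module _ {e : Arc n} {es : List (Arc n)} {b : SetFun n} (F : Feasible (e ∷ es) b) (M : Maximal es b e) where
  open Feasible F
  open Maximal M
  private
    i = proj₁ e
    j = proj₂ e

  tight : b S₀ B₀ ≡ + w
  tight = ℤP.≤-antisym
    (ℤP.≤-trans (ℤP.i<j⇒i≤pred[j] (proj₂ (proj₂ (proj₂ blocked)))) (ℤP.≤-reflexive refl))
    (ℤP.≮⇒≥ λ lt → fits S₀ B₀ (proj₁ blocked , proj₁ (proj₂ blocked) , proj₁ (proj₂ (proj₂ blocked)) , lt))

  -- Uncrossing with the tight pair (S₀ , B₀).
  lower : ∀ S B → Closed es S B → lookup S i ≡ true → lookup B j ≡ false → + 0 ≤ᶻ b S B + + w
  lower S B c p q = subst (+ 0 ≤ᶻ_) (trans (sym (modular S B S₀ B₀)) (cong (λ x → b S B + x) tight))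
    (0≤+ (nonneg _ _ (respects r∪ ∷ closed-∪ c (proj₁ blocked))) (nonneg _ _ (respects r∩ ∷ closed-∩ c (proj₁ blocked))))
    where
    r∪ : lookup (S ∪ S₀) i ≤ᴮ lookup (B ∪ B₀) j
    r∪ rewrite ∪-lookup S S₀ i | ∪-lookup B B₀ j | p | q | proj₁ (proj₂ (proj₂ blocked)) = b≤b
    r∩ : lookup (S ∩ S₀) i ≤ᴮ lookup (B ∩ B₀) j
    r∩ rewrite ∩-lookup S S₀ i | ∩-lookup B B₀ j | p | q | proj₁ (proj₂ blocked) = b≤b

  remainder : SetFun n
  remainder S B = b S B - + w * gain e S B

  -- Cuts containing both ends of `e` or neither keep their value. Those with `j` alone lose `w`,
  -- which `fits` allows. Those with `i` alone gain `w`, but were not closed while `e` was present;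
  -- for them `lower` works because the union with the tight pair contains both ends of `e` and the
  -- intersection contains neither, so both are closed for `e` as well.
  removeFeasible : Feasible es remainder
  removeFeasible = record
    { modular = remove-modular b e (+ w) modular
    ; empty = emp
    ; full = ful
    ; nonneg = nn
    }
    where
    sub0 : ∀ x w → x ≡ + 0 → x - w * + 0 ≡ + 0
    sub0 x w refl = lem w where
      lem : ∀ w → + 0 - w * + 0 ≡ + 0
      lem = solve-∀
    emp : remainder ⊥ ⊥ ≡ + 0
    emp rewrite VecP.lookup-replicate i false | VecP.lookup-replicate j false = sub0 _ (+ w) empty
    ful : remainder ⊤ ⊤ ≡ + 0
    ful rewrite VecP.lookup-replicate i true | VecP.lookup-replicate j true = sub0 _ (+ w) full
    stay : ∀ x w → x ≡ x - w * + 0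
    stay = solve-∀
    drop : ∀ x w → x + w ≡ x - w * (+ 0 - + 1)
    drop = solve-∀
    take : ∀ x w → x - w ≡ x - w * + 1
    take = solve-∀
    nn : ∀ S B → Closed es S B → + 0 ≤ᶻ remainder S B
    nn S B c with lookup S i in p | lookup B j in q
    ... | true  | true  = subst (+ 0 ≤ᶻ_) (stay (b S B) (+ w)) (nonneg S B (respects (subst₂ _≤ᴮ_ (sym p) (sym q) b≤b) ∷ c))
    ... | false | false = subst (+ 0 ≤ᶻ_) (stay (b S B) (+ w)) (nonneg S B (respects (subst₂ _≤ᴮ_ (sym p) (sym q) b≤b) ∷ c))
    ... | true  | false = subst (+ 0 ≤ᶻ_) (drop (b S B) (+ w)) (lower S B c p q)
    ... | false | true  = subst (+ 0 ≤ᶻ_) (take (b S B) (+ w))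
      (ℤP.i≤j⇒0≤j-i (ℤP.≮⇒≥ λ lt → fits S B (c , p , q , lt)))

  -- On the tight pair every arc of es with positive weight has gain 0, so an admissible
  -- circulation cannot increase the weight of e.
  extendGood : ∀ {W} → Good es W → (∀ S B → remainder S B ≡ val es (toℤ W) S B) → Good (e ∷ es) (w ∷ W)
  extendGood {W} G eq (z ∷ zs) circ (_ ∷ adm) (there refl lp) = G zs (λ S B → trans (zeroHead (gain e S B) (val es zs S B)) (circ S B)) adm lp
    where
    zeroHead : ∀ g v → v ≡ + 0 * g + v
    zeroHead = solve-∀
  extendGood {W} G eq (z ∷ zs) circ (_ ∷ adm) (here 0<z) =
    ℤP.<⇒≱ 0<z (ℤP.≤-trans (ℤP.≤-trans (ℤP.≤-reflexive (sym (ℤP.+-identityʳ z))) (ℤP.+-monoʳ-≤ z (slack es W zs (proj₁ blocked) adm val0)))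
      (ℤP.≤-reflexive (trans (cong (_+ val es zs S₀ B₀) z≡) (circ S₀ B₀))))
    where
    gain≡1 : gain e S₀ B₀ ≡ + 1
    gain≡1 rewrite proj₁ (proj₂ blocked) | proj₁ (proj₂ (proj₂ blocked)) = refl
    z≡ : z ≡ z * gain e S₀ B₀
    z≡ = sym (trans (cong (z *_) gain≡1) (ℤP.*-identityʳ z))
    val0 : val es (toℤ W) S₀ B₀ ≡ + 0
    val0 = trans (sym (eq S₀ B₀)) (trans (cong₂ (λ x g → x - + w * g) tight gain≡1) (cancel (+ w)))
      where
      cancel : ∀ w → w - w * + 1 ≡ + 0
      cancel = solve-∀
    slack : ∀ fs V ys → Closed fs S₀ B₀ → Admissible V ys → val fs (toℤ V) S₀ B₀ ≡ + 0 → + 0 ≤ᶻ val fs ys S₀ B₀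
    slack []       []      []       []       []       v0 = 0≤
    slack (f ∷ fs) (v ∷ V) (y ∷ ys) (r ∷ rs) (a ∷ as) v0 = 0≤+ hd (slack fs V ys rs as (proj₂ split))
      where
      split = sum-zero (0≤* (0≤ {v}) (0≤gain f S₀ B₀ r)) (0≤val fs V S₀ B₀ rs) v0
      hd : + 0 ≤ᶻ y * gain f S₀ B₀
      hd with ℤP.i*j≡0⇒i≡0∨j≡0 (+ v) (proj₁ split)
      ... | inj₁ refl = 0≤* (a refl) (0≤gain f S₀ B₀ r)
      ... | inj₂ g0   = ℤP.≤-reflexive (sym (trans (cong (y *_) g0) (ℤP.*-zeroʳ y)))

-- The order of the list is the lexicographic order, so maximizing each entry in turn yields a good
-- weighting. Integrality is automatic, since every entry is the value of a tight cut of an integral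
-- function.
goodFlow : ∀ (es : List (Arc n)) (b : SetFun n) → Feasible es b →
           Σ (Vec ℕ (length es)) λ W → Good es W × (∀ S B → b S B ≡ val es (toℤ W) S B)
goodFlow []       b F = [] , (λ { [] _ [] () }) , zeroOfFull F
goodFlow (e ∷ es) b F =
  let M = maximalExists F
      W , G , eq = goodFlow es (remainder F M) (removeFeasible F M)
      w = Maximal.w M
  in w ∷ W , extendGood F M G eq ,
     λ S B → trans (lem (b S B) (+ w) (gain e S B)) (cong (λ x → + w * gain e S B + x) (eq S B))
  where
  lem : ∀ x w g → x ≡ w * g + (x - w * g)
  lem = solve-∀

vec-ext : {xs ys : Vec A k} → (∀ i → lookup xs i ≡ lookup ys i) → xs ≡ ys
vec-ext {xs = xs} {ys} eq =
  trans (sym (VecP.tabulate∘lookup xs)) (trans (VecP.tabulate-cong eq) (VecP.tabulate∘lookup ys))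

zeros : ∀ k → Vec ℤ k
zeros k = replicate k (+ 0)

-- Margins of a weighting

dot : Subset n → Vec ℤ n → ℤ
dot []      []      = + 0
dot (s ∷ S) (x ∷ p) = ι s * x + dot S p

-- The row sums for π = proj₁ and the column sums for π = proj₂.
margin : (Arc n → Fin n) → (es : List (Arc n)) → Vec ℕ (length es) → Vec ℕ n
margin π []       []       = replicate _ 0
margin π (e ∷ es) (w ∷ ws) = updateAt (margin π es ws) (π e) (w ℕ.+_)

marginℤ : (Arc n → Fin n) → (es : List (Arc n)) → Vec ℤ (length es) → Vec ℤ n
marginℤ π []       []       = zeros _
marginℤ π (e ∷ es) (z ∷ zs) = updateAt (marginℤ π es zs) (π e) (λ x → z + x)

marginℤ-toℤ : ∀ (π : Arc n → Fin n) es W → marginℤ π es (toℤ W) ≡ toℤ (margin π es W)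
marginℤ-toℤ π []       []      = sym (VecP.map-replicate (+_) 0 _)
marginℤ-toℤ π (e ∷ es) (w ∷ W) =
  trans (cong (λ v → updateAt v (π e) (λ x → + w + x)) (marginℤ-toℤ π es W))
    (sym (VecP.map-updateAt {g = w ℕ.+_} {h = λ x → + w + x} (margin π es W) (π e) refl))

dot-updateAt : ∀ S (p : Vec ℤ n) i z → dot S (updateAt p i (λ x → z + x)) ≡ z * ι (lookup S i) + dot S p
dot-updateAt (s ∷ S) (x ∷ p) zero z = lem (ι s) x z (dot S p)
  where
  lem : ∀ s x z d → s * (z + x) + d ≡ z * s + (s * x + d)
  lem = solve-∀
dot-updateAt (s ∷ S) (x ∷ p) (suc i) z =
  trans (cong (λ d → ι s * x + d) (dot-updateAt S p i z)) (lem (ι s * x) (z * ι (lookup S i)) (dot S p))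
  where
  lem : ∀ a b c → a + (b + c) ≡ b + (a + c)
  lem = solve-∀

dot-zeros : ∀ (S : Subset n) → dot S (zeros n) ≡ + 0
dot-zeros []      = refl
dot-zeros (s ∷ S) = cong₂ _+_ (ℤP.*-zeroʳ (ι s)) (dot-zeros S)

dot-⊥ : ∀ (p : Vec ℤ n) → dot ⊥ p ≡ + 0
dot-⊥ []      = refl
dot-⊥ (x ∷ p) = cong (λ d → + 0 * x + d) (dot-⊥ p)

dot-⁅⁆ : ∀ i (p : Vec ℤ n) → dot ⁅ i ⁆ p ≡ lookup p i
dot-⁅⁆ zero    (x ∷ p) = trans (cong₂ _+_ (ℤP.*-identityˡ x) (dot-⊥ p)) (ℤP.+-identityʳ x)
dot-⁅⁆ (suc i) (x ∷ p) = trans (cong (λ d → + 0 * x + d) (dot-⁅⁆ i p)) (ℤP.+-identityˡ _)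

dot-toℤ : ∀ S (x : Vec ℕ n) → dot S (toℤ x) ≡ + sumOver S x
dot-toℤ []          []      = refl
dot-toℤ (true ∷ S)  (x ∷ v) = trans (cong₂ _+_ (ℤP.*-identityˡ (+ x)) (dot-toℤ S v)) (sym (ℤP.pos-+ x _))
dot-toℤ (false ∷ S) (x ∷ v) = trans (ℤP.+-identityˡ _) (dot-toℤ S v)

dot-modular : ∀ S T (p : Vec ℤ n) → dot S p + dot T p ≡ dot (S ∪ T) p + dot (S ∩ T) p
dot-modular []      []      []      = refl
dot-modular (s ∷ S) (t ∷ T) (x ∷ p) =
  trans (lem (ι s) (ι t) x (dot S p) (dot T p))
    (trans (cong₂ (λ u v → u * x + v) (ι-modular s t) (dot-modular S T p))
      (sym (lem (ι (s ∨ t)) (ι (s ∧ t)) x (dot (S ∪ T) p) (dot (S ∩ T) p))))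
  where
  lem : ∀ s t x a b → (s * x + a) + (t * x + b) ≡ (s + t) * x + (a + b)
  lem = solve-∀

val-margin : ∀ (es : List (Arc n)) z S B →
             val es z S B ≡ dot B (marginℤ proj₂ es z) - dot S (marginℤ proj₁ es z)
val-margin []       []       S B = sym (cong₂ _-_ (dot-zeros B) (dot-zeros S))
val-margin (e ∷ es) (z ∷ zs) S B =
  trans (cong (λ v → z * gain e S B + v) (val-margin es zs S B))
    (trans (lem z (ι (lookup B (proj₂ e))) (ι (lookup S (proj₁ e))) (dot B (marginℤ proj₂ es zs)) (dot S (marginℤ proj₁ es zs)))
      (sym (cong₂ _-_ (dot-updateAt B (marginℤ proj₂ es zs) (proj₂ e) z) (dot-updateAt S (marginℤ proj₁ es zs) (proj₁ e) z))))
  where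
  lem : ∀ z c r b s → z * (c - r) + (b - s) ≡ (z * c + b) - (z * r + s)
  lem = solve-∀

val-col : ∀ (es : List (Arc n)) z j → val es z ⊥ ⁅ j ⁆ ≡ lookup (marginℤ proj₂ es z) j
val-col es z j = trans (val-margin es z ⊥ ⁅ j ⁆)
  (trans (cong₂ _-_ (dot-⁅⁆ j (marginℤ proj₂ es z)) (dot-⊥ (marginℤ proj₁ es z))) (ℤP.+-identityʳ _))

val-row : ∀ (es : List (Arc n)) z i → val es z ⁅ i ⁆ ⊥ ≡ - lookup (marginℤ proj₁ es z) i
val-row es z i = trans (val-margin es z ⁅ i ⁆ ⊥)
  (trans (cong₂ _-_ (dot-⊥ (marginℤ proj₂ es z)) (dot-⁅⁆ i (marginℤ proj₁ es z))) (ℤP.+-identityˡ _))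

val-⊤ : ∀ (es : List (Arc n)) z → val es z ⊤ ⊤ ≡ + 0
val-⊤ []       []       = refl
val-⊤ (e ∷ es) (z ∷ zs)
  rewrite VecP.lookup-replicate (proj₁ e) true | VecP.lookup-replicate (proj₂ e) true =
  trans (cong₂ _+_ (ℤP.*-zeroʳ z) (val-⊤ es zs)) refl

circ⇒margins : ∀ (es : List (Arc n)) {z} → Circ es z → marginℤ proj₁ es z ≡ zeros n × marginℤ proj₂ es z ≡ zeros n
circ⇒margins es {z} c =
    vec-ext (λ i → trans (ℤP.neg-injective (trans (sym (val-row es z i)) (c ⁅ i ⁆ ⊥))) (sym (VecP.lookup-replicate i (+ 0))))
  , vec-ext (λ j → trans (trans (sym (val-col es z j)) (c ⊥ ⁅ j ⁆)) (sym (VecP.lookup-replicate j (+ 0))))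

margins⇒circ : ∀ (es : List (Arc n)) {z} → marginℤ proj₁ es z ≡ zeros n → marginℤ proj₂ es z ≡ zeros n → Circ es z
margins⇒circ es {z} p q S B =
  trans (val-margin es z S B) (cong₂ _-_ (trans (cong (dot B) q) (dot-zeros B)) (trans (cong (dot S) p) (dot-zeros S)))

sumOver-⊤ : ∀ (x : Vec ℕ n) → sumOver ⊤ x ≡ sumℕ x
sumOver-⊤ []      = refl
sumOver-⊤ (x ∷ v) = cong (x ℕ.+_) (sumOver-⊤ v)

sumℕ-updateAt : ∀ (x : Vec ℕ n) i w → sumℕ (updateAt x i (w ℕ.+_)) ≡ w ℕ.+ sumℕ x
sumℕ-updateAt (x ∷ v) zero    w = ℕP.+-assoc w x (sumℕ v)
sumℕ-updateAt (x ∷ v) (suc i) w = trans (cong (x ℕ.+_) (sumℕ-updateAt v i w))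
  (trans (sym (ℕP.+-assoc x w _)) (trans (cong (ℕ._+ sumℕ v) (ℕP.+-comm x w)) (ℕP.+-assoc w x _)))

sumℕ-zeros : ∀ k → sumℕ (replicate k 0) ≡ 0
sumℕ-zeros zero    = refl
sumℕ-zeros (suc k) = sumℕ-zeros k

sumℕ-margin : ∀ (π : Arc n → Fin n) es W → sumℕ (margin π es W) ≡ sumℕ W
sumℕ-margin {n} π []       []      = sumℕ-zeros n
sumℕ-margin     π (e ∷ es) (w ∷ W) = trans (sumℕ-updateAt (margin π es W) (π e) w) (cong (w ℕ.+_) (sumℕ-margin π es W))

HasMargins : (es : List (Arc n)) → Vec ℕ (length es) → Vec ℕ n → Vec ℕ n → Set
HasMargins es W x y = margin proj₁ es W ≡ x × margin proj₂ es W ≡ y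

val-toℤ : ∀ (es : List (Arc n)) {W x y} → HasMargins es W x y →
          ∀ S B → val es (toℤ W) S B ≡ + sumOver B y - + sumOver S x
val-toℤ es {W} (refl , refl) S B = trans (val-margin es (toℤ W) S B)
  (cong₂ _-_ (trans (cong (dot B) (marginℤ-toℤ proj₂ es W)) (dot-toℤ B (margin proj₂ es W)))
             (trans (cong (dot S) (marginℤ-toℤ proj₁ es W)) (dot-toℤ S (margin proj₁ es W))))

record Transportable (es : List (Arc n)) (x y : Vec ℕ n) : Set where
  field
    balanced : sumℕ x ≡ sumℕ y
    cut      : ∀ S B → Closed es S B → sumOver S x ≤ sumOver B y

hasMargins⇒transportable : ∀ (es : List (Arc n)) {W x y} → HasMargins es W x y → Transportable es x y
hasMargins⇒transportable es {W} m@(refl , refl) = record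
  { balanced = trans (sumℕ-margin proj₁ es W) (sym (sumℕ-margin proj₂ es W))
  ; cut = λ S B c → ℤP.drop‿+≤+ (ℤP.0≤i-j⇒j≤i (subst (+ 0 ≤ᶻ_) (val-toℤ es m S B) (0≤val es W S B c)))
  }

-- Gale's condition for `x` and `y` is feasibility of the cut function that they define. Agreement
-- of cut functions on single rows and single columns returns the margins.
transport : ∀ (es : List (Arc n)) {x y} → Transportable es x y →
            Σ (Vec ℕ (length es)) λ W → Good es W × HasMargins es W x y
transport {n} es {x} {y} T with goodFlow es b feasible
  where
  open Transportable T
  b : SetFun n
  b S B = dot B (toℤ y) - dot S (toℤ x)
  lem : ∀ a b c d → (a - b) + (c - d) ≡ (a + c) - (b + d)
  lem = solve-∀
  dot-⊤ : ∀ v → dot ⊤ (toℤ v) ≡ + sumℕ v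
  dot-⊤ v = trans (dot-toℤ ⊤ v) (cong (+_) (sumOver-⊤ v))
  feasible : Feasible es b
  feasible = record
    { modular = λ S B S′ B′ → trans (lem (dot B (toℤ y)) (dot S (toℤ x)) (dot B′ (toℤ y)) (dot S′ (toℤ x)))
        (trans (cong₂ _-_ (dot-modular B B′ (toℤ y)) (dot-modular S S′ (toℤ x)))
          (sym (lem (dot (B ∪ B′) (toℤ y)) (dot (S ∪ S′) (toℤ x)) (dot (B ∩ B′) (toℤ y)) (dot (S ∩ S′) (toℤ x)))))
    ; empty = cong₂ _-_ (dot-⊥ (toℤ y)) (dot-⊥ (toℤ x))
    ; full = trans (cong₂ _-_ (dot-⊤ y) (trans (dot-⊤ x) (cong (+_) balanced))) (ℤP.+-inverseʳ (+ sumℕ y))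
    ; nonneg = λ S B c → ℤP.i≤j⇒0≤j-i (subst₂ _≤ᶻ_ (sym (dot-toℤ S x)) (sym (dot-toℤ B y)) (+≤+ (cut S B c)))
    }
... | W , good , eq = W , good , rows , cols
  where
  pt : ∀ (v : Vec ℕ n) i → lookup (toℤ v) i ≡ + lookup v i
  pt v i = VecP.lookup-map i (+_) v
  rows : margin proj₁ es W ≡ x
  rows = vec-ext λ i → ℤP.+-injective (trans (sym (pt (margin proj₁ es W) i)) (trans
    (ℤP.neg-injective (trans (cong (λ v → - lookup v i) (sym (marginℤ-toℤ proj₁ es W))) (trans (sym (val-row es (toℤ W) i))
      (trans (sym (eq ⁅ i ⁆ ⊥)) (trans (cong₂ _-_ (dot-⊥ (toℤ y)) (dot-⁅⁆ i (toℤ x))) (ℤP.+-identityˡ _)))))) (pt x i)))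
  cols : margin proj₂ es W ≡ y
  cols = vec-ext λ j → ℤP.+-injective (trans (sym (pt (margin proj₂ es W) j)) (trans
    (trans (cong (λ v → lookup v j) (sym (marginℤ-toℤ proj₂ es W))) (trans (sym (val-col es (toℤ W) j))
      (trans (sym (eq ⊥ ⁅ j ⁆)) (trans (cong₂ _-_ (dot-⁅⁆ j (toℤ y)) (dot-⊥ (toℤ x))) (ℤP.+-identityʳ _))))) (pt y j)))

-- Uniqueness of good weightings

diff : Vec ℕ k → Vec ℕ k → Vec ℤ k
diff = zipWith (λ a b → + a - + b)

lexCompare : ∀ (V W : Vec ℕ k) → LexPos (diff V W) ⊎ V ≡ W ⊎ LexPos (diff W V)
lexCompare []      []      = inj₂ (inj₁ refl)
lexCompare (v ∷ V) (w ∷ W) with ℕP.<-cmp v w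
... | tri< lt _ _ = inj₂ (inj₂ (here (ℤP.≤-<-trans (ℤP.≤-reflexive (sym (ℤP.+-inverseʳ (+ v)))) (ℤP.+-monoˡ-< (- + v) (+<+ lt)))))
... | tri> _ _ gt = inj₁ (here (ℤP.≤-<-trans (ℤP.≤-reflexive (sym (ℤP.+-inverseʳ (+ w)))) (ℤP.+-monoˡ-< (- + w) (+<+ gt))))
... | tri≈ _ refl _ with lexCompare V W
...   | inj₁ p        = inj₁ (there (ℤP.+-inverseʳ (+ v)) p)
...   | inj₂ (inj₁ p) = inj₂ (inj₁ (cong (v ∷_) p))
...   | inj₂ (inj₂ p) = inj₂ (inj₂ (there (ℤP.+-inverseʳ (+ v)) p))

diff-admissible : ∀ (V W : Vec ℕ k) → Admissible W (diff V W)
diff-admissible []      []      = []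
diff-admissible (v ∷ V) (w ∷ W) = (λ { refl → subst (+ 0 ≤ᶻ_) (sym (ℤP.+-identityʳ (+ v))) 0≤ }) ∷ diff-admissible V W

val-diff : ∀ (es : List (Arc n)) V W S B → val es (diff V W) S B ≡ val es (toℤ V) S B - val es (toℤ W) S B
val-diff []       []      []      S B = refl
val-diff (e ∷ es) (v ∷ V) (w ∷ W) S B =
  trans (cong (λ x → (+ v - + w) * gain e S B + x) (val-diff es V W S B))
    (lem (+ v) (+ w) (gain e S B) (val es (toℤ V) S B) (val es (toℤ W) S B))
  where
  lem : ∀ v w g a b → (v - w) * g + (a - b) ≡ (v * g + a) - (w * g + b)
  lem = solve-∀

diff-circ : ∀ (es : List (Arc n)) {V W x y} → HasMargins es V x y → HasMargins es W x y → Circ es (diff V W)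
diff-circ es {V} {W} {x} {y} p q S B = trans (val-diff es V W S B)
  (trans (cong₂ _-_ (val-toℤ es p S B) (val-toℤ es q S B)) (ℤP.+-inverseʳ (+ sumOver B y - + sumOver S x)))

-- If the two differed, their difference would be a circulation raising the lexicographically
-- smaller one; it is admissible there because the larger one is nonnegative.
good-unique : ∀ (es : List (Arc n)) {V W x y} → Good es V → Good es W →
              HasMargins es V x y → HasMargins es W x y → V ≡ W
good-unique es {V} {W} gV gW p q with lexCompare V W
... | inj₁ pos        = ⊥-elim (gW (diff V W) (diff-circ es p q) (diff-admissible V W) pos)
... | inj₂ (inj₁ eq)  = eq
... | inj₂ (inj₂ pos) = ⊥-elim (gV (diff W V) (diff-circ es q p) (diff-admissible W V) pos)

-- Good supports are forests

data SupportedIn : Vec ℕ k → Subset k → Set where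
  []  : SupportedIn [] []
  _∷_ : ∀ {w b} {W : Vec ℕ k} {F} → (b ≡ false → w ≡ 0) → SupportedIn W F → SupportedIn (w ∷ W) (b ∷ F)

nonzero : ℕ → Bool
nonzero 0       = false
nonzero (suc _) = true

support : Vec ℕ k → Subset k
support = Vec.map nonzero

indicator : Subset k → Vec ℕ k
indicator = Vec.map (λ b → if b then 1 else 0)

support-indicator : ∀ (F : Subset k) → support (indicator F) ≡ F
support-indicator []          = refl
support-indicator (true ∷ F)  = cong (true ∷_) (support-indicator F)
support-indicator (false ∷ F) = cong (false ∷_) (support-indicator F)

supported-support : ∀ (W : Vec ℕ k) → SupportedIn W (support W)
supported-support []          = []
supported-support (zero ∷ W)  = (λ _ → refl) ∷ supported-support W
supported-support (suc w ∷ W) = (λ ()) ∷ supported-support W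

GoodSet : (es : List (Arc n)) → Subset (length es) → Set
GoodSet es F = Good es (indicator F)

-- A smaller support imposes more sign conditions, so fewer directions compete. In particular
-- subsets of good sets are good, as faces of a simplicial complex must be.
good-supported : ∀ (es : List (Arc n)) {W F} → GoodSet es F → SupportedIn W F → Good es W
good-supported es G s z c a = G z c (go s a)
  where
  go : ∀ {k} {W : Vec ℕ k} {F z} → SupportedIn W F → Admissible W z → Admissible (indicator F) z
  go []                  []      = []
  go {F = true ∷ _}  (s ∷ ss) (a ∷ as) = (λ ()) ∷ go ss as
  go {F = false ∷ _} (s ∷ ss) (a ∷ as) = (λ _ → a (s refl)) ∷ go ss as

goodSet-support : ∀ (es : List (Arc n)) {W} → Good es W → GoodSet es (support W)
goodSet-support es {W} G z c a = G z c (go W a)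
  where
  go : ∀ {k} (W : Vec ℕ k) {z} → Admissible (indicator (support W)) z → Admissible W z
  go []          []       = []
  go (zero ∷ W)  (a ∷ as) = (λ _ → a refl) ∷ go W as
  go (suc w ∷ W) (a ∷ as) = (λ ()) ∷ go W as

-- No nonzero circulation, that is, the arcs form a forest; equivalently their vertices (e_i , e_j)
-- are linearly independent.
Independent : List (Arc n) → Set
Independent es = ∀ c → Circ es c → c ≡ zeros (length es)

extend : {xs ys : List A} {X : Set} → X → xs ⊑ ys → Vec X (length xs) → Vec X (length ys)
extend o []       []      = []
extend o (y ∷ʳ τ) c       = o ∷ extend o τ c
extend o (_ ∷ τ)  (x ∷ c) = x ∷ extend o τ c

val-extend : ∀ {fs es : List (Arc n)} (τ : fs ⊑ es) c S B → val es (extend (+ 0) τ c) S B ≡ val fs c S B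
val-extend []         []      S B = refl
val-extend (e ∷ʳ τ)   c       S B = trans (cong₂ _+_ (ℤP.*-zeroˡ (gain e S B)) (val-extend τ c S B)) (ℤP.+-identityˡ _)
val-extend (refl ∷ τ) (z ∷ c) S B = cong (λ v → z * _ + v) (val-extend τ c S B)

extend-zero : {xs ys : List A} (τ : xs ⊑ ys) (c : Vec ℤ (length xs)) → extend (+ 0) τ c ≡ zeros (length ys) → c ≡ zeros (length xs)
extend-zero []       []      _  = refl
extend-zero (y ∷ʳ τ) c       eq = extend-zero τ c (VecP.∷-injectiveʳ eq)
extend-zero (_ ∷ τ)  (x ∷ c) eq = cong₂ _∷_ (VecP.∷-injectiveˡ eq) (extend-zero τ c (VecP.∷-injectiveʳ eq))

independent-⊑ : ∀ {fs es : List (Arc n)} → fs ⊑ es → Independent es → Independent fs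
independent-⊑ τ ind c circ = extend-zero τ c (ind _ (λ S B → trans (val-extend τ c S B) (circ S B)))

margin-extend : ∀ (π : Arc n → Fin n) {fs es} (τ : fs ⊑ es) W → margin π es (extend 0 τ W) ≡ margin π fs W
margin-extend π []         []      = refl
margin-extend π (e ∷ʳ τ)   W       = trans (VecP.updateAt-id-local (π e) _ refl) (margin-extend π τ W)
margin-extend π (refl ∷ τ) (w ∷ W) = cong (λ v → updateAt v (π _) (w ℕ.+_)) (margin-extend π τ W)

select : (xs : List A) → Subset (length xs) → List A
select []       []          = []
select (x ∷ xs) (true ∷ F)  = x ∷ select xs F
select (x ∷ xs) (false ∷ F) = select xs F

select-⊑ : ∀ (xs : List A) F → select xs F ⊑ xs
select-⊑ []       []          = []
select-⊑ (x ∷ xs) (true ∷ F)  = refl ∷ select-⊑ xs F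
select-⊑ (x ∷ xs) (false ∷ F) = x ∷ʳ select-⊑ xs F

length-select : ∀ (xs : List A) F → length (select xs F) ≡ card F
length-select []       []          = refl
length-select (x ∷ xs) (true ∷ F)  = cong suc (length-select xs F)
length-select (x ∷ xs) (false ∷ F) = length-select xs F

supported-extend : ∀ (xs : List A) F W → SupportedIn (extend 0 (select-⊑ xs F) W) F
supported-extend []       []          []      = []
supported-extend (x ∷ xs) (true ∷ F)  (w ∷ W) = (λ ()) ∷ supported-extend xs F W
supported-extend (x ∷ xs) (false ∷ F) W       = (λ _ → refl) ∷ supported-extend xs F W

negate : Vec ℤ k → Vec ℤ k
negate = Vec.map (-_)

val-negate : ∀ (es : List (Arc n)) z S B → val es (negate z) S B ≡ - val es z S B
val-negate []       []      S B = refl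
val-negate (e ∷ es) (z ∷ zs) S B =
  trans (cong (λ v → (- z) * gain e S B + v) (val-negate es zs S B)) (lem z (gain e S B) (val es zs S B))
  where
  lem : ∀ z g v → (- z) * g + (- v) ≡ - (z * g + v)
  lem = solve-∀

lexSign : ∀ (z : Vec ℤ k) → LexPos z ⊎ z ≡ zeros k ⊎ LexPos (negate z)
lexSign []      = inj₂ (inj₁ refl)
lexSign (x ∷ z) with ℤP.<-cmp x (+ 0)
... | tri< lt _ _ = inj₂ (inj₂ (here (ℤP.neg-mono-< lt)))
... | tri> _ _ gt = inj₁ (here gt)
... | tri≈ _ refl _ with lexSign z
...   | inj₁ p        = inj₁ (there refl p)
...   | inj₂ (inj₁ p) = inj₂ (inj₁ (cong (+ 0 ∷_) p))
...   | inj₂ (inj₂ p) = inj₂ (inj₂ (there refl p))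

-- A nonzero circulation on `F` or its negative is lexicographically positive, and both are
-- admissible because every weight on `F` is positive.
goodSet-independent : ∀ (es : List (Arc n)) {F} → GoodSet es F → Independent (select es F)
goodSet-independent es {F} G c circ with lexSign (extend (+ 0) (select-⊑ es F) c)
... | inj₁ p        = ⊥-elim (G _ (λ S B → trans (val-extend (select-⊑ es F) c S B) (circ S B)) (adm es F c) p)
  where
  adm : ∀ (xs : List A) F c → Admissible (indicator F) (extend (+ 0) (select-⊑ xs F) c)
  adm []       []          []      = []
  adm (x ∷ xs) (true ∷ F)  (z ∷ c) = (λ ()) ∷ adm xs F c
  adm (x ∷ xs) (false ∷ F) c       = (λ _ → 0≤) ∷ adm xs F c
... | inj₂ (inj₁ p) = extend-zero (select-⊑ es F) c p
... | inj₂ (inj₂ p) = ⊥-elim (G _ (λ S B → trans (val-negate es _ S B) (cong -_ (trans (val-extend (select-⊑ es F) c S B) (circ S B)))) (adm es F c) p)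
  where
  adm : ∀ (xs : List A) F c → Admissible (indicator F) (negate (extend (+ 0) (select-⊑ xs F) c))
  adm []       []          []      = []
  adm (x ∷ xs) (true ∷ F)  (z ∷ c) = (λ ()) ∷ adm xs F c
  adm (x ∷ xs) (false ∷ F) c       = (λ _ → 0≤) ∷ adm xs F c

-- Linear dependence

lin : (A → ℤ) → (xs : List A) → Vec ℤ (length xs) → ℤ
lin f []       []      = + 0
lin f (x ∷ xs) (z ∷ zs) = z * f x + lin f xs zs

pivot : ∀ (x : A) (fs : List (A → ℤ)) → All (λ f → f x ≡ + 0) fs ⊎
        Σ (A → ℤ) λ f → Σ (List (A → ℤ)) λ gs → f x ≢ + 0 × length fs ≡ suc (length gs) ×
        (∀ {P : (A → ℤ) → Set} → P f → All P gs → All P fs)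
pivot x []       = inj₁ []
pivot x (f ∷ fs) with f x ℤP.≟ + 0
... | no f≢0 = inj₂ (f , fs , f≢0 , refl , λ p ps → p ∷ ps)
... | yes f0 with pivot x fs
...   | inj₁ all = inj₁ (f0 ∷ all)
...   | inj₂ (g , gs , g≢0 , eq , back) = inj₂ (g , f ∷ gs , g≢0 , cong suc eq , λ { p (q ∷ ps) → q ∷ back p ps })

lin-zeros : ∀ (f : A → ℤ) xs → lin f xs (zeros (length xs)) ≡ + 0
lin-zeros f []       = refl
lin-zeros f (x ∷ xs) = trans (cong₂ _+_ (ℤP.*-zeroˡ (f x)) (lin-zeros f xs)) refl

lin-scale : ∀ (f : A → ℤ) a xs c → lin f xs (Vec.map (a *_) c) ≡ a * lin f xs c
lin-scale f a []       []      = sym (ℤP.*-zeroʳ a)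
lin-scale f a (x ∷ xs) (z ∷ c) = trans (cong (λ v → a * z * f x + v) (lin-scale f a xs c)) (lem a z (f x) (lin f xs c))
  where
  lem : ∀ a z f l → a * z * f + a * l ≡ a * (z * f + l)
  lem = solve-∀

lin-comb : ∀ (f g : A → ℤ) a b xs c → lin (λ y → a * g y - f y * b) xs c ≡ a * lin g xs c - lin f xs c * b
lin-comb f g a b []       []      = lem a b
  where
  lem : ∀ a b → + 0 ≡ a * + 0 - + 0 * b
  lem = solve-∀
lin-comb f g a b (x ∷ xs) (z ∷ c) =
  trans (cong (λ v → z * (a * g x - f x * b) + v) (lin-comb f g a b xs c)) (lem a b z (f x) (g x) (lin f xs c) (lin g xs c))
  where
  lem : ∀ a b z f g l m → z * (a * g - f * b) + (a * m - l * b) ≡ a * (z * g + m) - (z * f + l) * b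
  lem = solve-∀

scale-zero : ∀ {a} (c : Vec ℤ k) → a ≢ + 0 → Vec.map (a *_) c ≡ zeros k → c ≡ zeros k
scale-zero         []      _   _  = refl
scale-zero {a = a} (z ∷ c) a≢0 eq with ℤP.i*j≡0⇒i≡0∨j≡0 a (VecP.∷-injectiveˡ eq)
... | inj₁ a≡0  = contradiction a≡0 a≢0
... | inj₂ refl = cong (+ 0 ∷_) (scale-zero c a≢0 (VecP.∷-injectiveʳ eq))

-- Gaussian elimination: the first element eliminates one functional that does not vanish on it.
dependent : ∀ (fs : List (A → ℤ)) (xs : List A) → length fs ℕ.< length xs →
            Σ (Vec ℤ (length xs)) λ c → c ≢ zeros (length xs) × All (λ f → lin f xs c ≡ + 0) fs
dependent fs []       ()
dependent fs (x ∷ xs) lt with pivot x fs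
... | inj₁ all = + 1 ∷ zeros _ , (λ ()) ,
      All.map (λ {f} f0 → trans (cong₂ _+_ (trans (ℤP.*-identityˡ (f x)) f0) (lin-zeros f xs)) refl) all
... | inj₂ (f , gs , f≢0 , len , back) with dependent (List.map (λ g y → f x * g y - f y * g x) gs) xs
        (subst (ℕ._< length xs) (sym (ListP.length-map _ gs)) (ℕP.≤-pred (subst (ℕ._< suc (length xs)) len lt)))
...   | c , c≢0 , zs = (- lin f xs c) ∷ Vec.map (f x *_) c , (λ eq → c≢0 (scale-zero c f≢0 (VecP.∷-injectiveʳ eq))) ,
        back (trans (cong (λ v → - lin f xs c * f x + v) (lin-scale f (f x) xs c)) (lemf (f x) (lin f xs c)))
             (All.map (λ {g} g0 → trans (cong (λ v → - lin f xs c * g x + v) (lin-scale g (f x) xs c))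
                 (trans (lemg (f x) (g x) (lin f xs c) (lin g xs c)) (trans (sym (lin-comb f g (f x) (g x) xs c)) g0)))
               (AllP.map⁻ zs))
  where
  lemf : ∀ a l → - l * a + a * l ≡ + 0
  lemf = solve-∀
  lemg : ∀ a b l m → - l * b + a * m ≡ a * m - l * b
  lemg = solve-∀

-- The bound on the number of arcs of a forest

elements : Subset n → List (Fin n)
elements []          = []
elements (true ∷ S)  = zero ∷ List.map suc (elements S)
elements (false ∷ S) = List.map suc (elements S)

length-elements : ∀ (S : Subset n) → length (elements S) ≡ card S
length-elements []          = refl
length-elements (true ∷ S)  = cong suc (trans (ListP.length-map suc (elements S)) (length-elements S))
length-elements (false ∷ S) = trans (ListP.length-map suc (elements S)) (length-elements S)

∈-elements : ∀ (S : Subset n) i → lookup S i ≡ true → i ∈ elements S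
∈-elements (true ∷ S)  zero    _ = here refl
∈-elements (true ∷ S)  (suc i) p = there (∈-map⁺ suc (∈-elements S i p))
∈-elements (false ∷ S) (suc i) p = ∈-map⁺ suc (∈-elements S i p)

lin-val : ∀ (es : List (Arc n)) c S B → lin (λ e → gain e S B) es c ≡ val es c S B
lin-val []       []      S B = refl
lin-val (e ∷ es) (z ∷ c) S B = cong (λ v → z * gain e S B + v) (lin-val es c S B)

Within : Subset n → Subset n → Arc n → Set
Within S B (i , j) = lookup S i ≡ true × lookup B j ≡ true

lookup-updateAt-≢ : ∀ (p : Vec A n) i j {f} → j ≢ i → lookup (updateAt p i f) j ≡ lookup p j
lookup-updateAt-≢ p i j ne = VecP.lookup∘updateAt′ j i ne p

marginℤ-outside : ∀ (π : Arc n → Fin n) es c i → All (λ e → π e ≢ i) es → lookup (marginℤ π es c) i ≡ + 0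
marginℤ-outside π []       []      i []       = VecP.lookup-replicate i (+ 0)
marginℤ-outside π (e ∷ es) (z ∷ c) i (p ∷ ps) =
  trans (lookup-updateAt-≢ (marginℤ π es c) (π e) i (λ eq → p (sym eq))) (marginℤ-outside π es c i ps)

dot-⊤-single : ∀ (p : Vec ℤ n) i → (∀ j → j ≢ i → lookup p j ≡ + 0) → dot ⊤ p ≡ lookup p i
dot-⊤-single {n} p i z = trans (cong (dot ⊤) p≡) (trans (dot-updateAt ⊤ (zeros _) i (lookup p i))
    (trans (cong₂ _+_ (trans (cong (λ b → lookup p i * ι b) (VecP.lookup-replicate i true)) (ℤP.*-identityʳ (lookup p i))) (dot-zeros {n = n} ⊤)) (ℤP.+-identityʳ (lookup p i))))
  where
  p≡ : p ≡ updateAt (zeros _) i (λ x → lookup p i + x)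
  p≡ = vec-ext go
    where
    go : ∀ j → lookup p j ≡ lookup (updateAt (zeros _) i (λ x → lookup p i + x)) j
    go j with j Fin.≟ i
    ... | yes refl = sym (trans (VecP.lookup∘updateAt i (zeros _)) (trans (cong (λ x → lookup p i + x) (VecP.lookup-replicate i (+ 0))) (ℤP.+-identityʳ _)))
    ... | no ne = trans (z j ne) (sym (trans (lookup-updateAt-≢ (zeros _) i j ne) (VecP.lookup-replicate j (+ 0))))

-- The row coordinate s is redundant, since the total of the rows equals the total of the columns.
independent-bound : ∀ (es : List (Arc n)) S B s → lookup S s ≡ true → All (Within S B) es → Independent es →
                    length es ℕ.< card S ℕ.+ card B
independent-bound {n} es S B s s∈S within ind with length es ℕP.<? card S ℕ.+ card B
... | yes lt = lt
... | no ¬lt with dependent functionals es few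
  where
  rowF colF : Fin n → Arc n → ℤ
  rowF i e = gain e ⁅ i ⁆ ⊥
  colF j e = gain e ⊥ ⁅ j ⁆
  functionals : List (Arc n → ℤ)
  functionals = List.map rowF (elements (S without s)) List.++ List.map colF (elements B)
  few : length functionals ℕ.< length es
  few = ℕP.<-≤-trans (subst (ℕ._< card S ℕ.+ card B)
    (sym (trans (ListP.length-++ (List.map rowF (elements (S without s))))
      (cong₂ ℕ._+_ (trans (ListP.length-map rowF (elements (S without s))) (length-elements (S without s)))
                   (trans (ListP.length-map colF (elements B)) (length-elements B)))))
    (ℕP.+-monoˡ-< (card B) (x∈p⇒∣p-x∣<∣p∣ (VecP.lookup⇒[]= s S s∈S)))) (ℕP.≮⇒≥ ¬lt)
... | c , c≢0 , zs = contradiction (ind c (margins⇒circ es (vec-ext rows0) (vec-ext cols0))) c≢0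
  where
  p q : Vec ℤ n
  p = marginℤ proj₁ es c
  q = marginℤ proj₂ es c
  outside : ∀ (π : Arc n → Fin n) T i → lookup T i ≡ false → All (λ e → lookup T (π e) ≡ true) es → All (λ e → π e ≢ i) es
  outside π T i out = All.map λ { inn refl → contradiction (trans (sym inn) out) λ () }
  halves = AllP.++⁻ (List.map _ (elements (S without s))) zs
  rowsS : ∀ i → i ∈ elements (S without s) → lookup p i ≡ + 0
  rowsS i m = ℤP.neg-injective (trans (sym (val-row es c i)) (trans (sym (lin-val es c ⁅ i ⁆ ⊥)) (All.lookup (AllP.map⁻ (proj₁ halves)) m)))
  colsB : ∀ j → j ∈ elements B → lookup q j ≡ + 0
  colsB j m = trans (sym (val-col es c j)) (trans (sym (lin-val es c ⊥ ⁅ j ⁆)) (All.lookup (AllP.map⁻ (proj₂ halves)) m))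
  q0 : ∀ j → lookup q j ≡ + 0
  q0 j with lookup B j in eq
  ... | true  = colsB j (∈-elements B j eq)
  ... | false = marginℤ-outside proj₂ es c j (outside proj₂ B j eq (All.map proj₂ within))
  p0 : ∀ i → i ≢ s → lookup p i ≡ + 0
  p0 i ne with lookup S i in eq
  ... | true  = rowsS i (∈-elements (S without s) i (VecP.[]=⇒lookup (x∈p∧x≢y⇒x∈p-y (VecP.lookup⇒[]= i S eq) ne)))
  ... | false = marginℤ-outside proj₁ es c i (outside proj₁ S i eq (All.map proj₁ within))
  cols0 : ∀ j → lookup q j ≡ lookup (zeros n) j
  cols0 j = trans (q0 j) (sym (VecP.lookup-replicate j (+ 0)))
  ps : lookup p s ≡ + 0
  ps = trans (sym (dot-⊤-single p s p0)) (ℤP.neg-injective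
    (trans (sym (ℤP.+-identityˡ _)) (trans (cong (_- dot ⊤ p) (sym (trans (cong (dot ⊤) (vec-ext cols0)) (dot-zeros {n = n} ⊤))))
      (trans (sym (val-margin es c ⊤ ⊤)) (val-⊤ es c)))))
  rows0 : ∀ i → lookup p i ≡ lookup (zeros n) i
  rows0 i with i Fin.≟ s
  ... | yes refl = trans ps (sym (VecP.lookup-replicate i (+ 0)))
  ... | no ne    = trans (p0 i ne) (sym (VecP.lookup-replicate i (+ 0)))

sumOver-updateAt : ∀ S (x : Vec ℕ n) i w → sumOver S (updateAt x i (w ℕ.+_)) ≡ (if lookup S i then w else 0) ℕ.+ sumOver S x
sumOver-updateAt (true ∷ S)  (x ∷ v) zero w    = ℕP.+-assoc w x (sumOver S v)
sumOver-updateAt (false ∷ S) (x ∷ v) zero w    = refl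
sumOver-updateAt (false ∷ S) (x ∷ v) (suc i) w = sumOver-updateAt S v i w
sumOver-updateAt (true ∷ S)  (x ∷ v) (suc i) w =
  trans (cong (x ℕ.+_) (sumOver-updateAt S v i w)) (x∙yz≈y∙xz x (if lookup S i then w else 0) (sumOver S v))

sumOver-replicate : ∀ (S : Subset n) w → sumOver S (replicate n w) ≡ w ℕ.* card S
sumOver-replicate []          w = sym (ℕP.*-zeroʳ w)
sumOver-replicate (true ∷ S)  w = trans (cong (w ℕ.+_) (sumOver-replicate S w)) (sym (ℕP.*-suc w (card S)))
sumOver-replicate (false ∷ S) w = sumOver-replicate S w

sumℕ-replicate : ∀ n w → sumℕ (replicate n w) ≡ w ℕ.* n
sumℕ-replicate n w = trans (sym (sumOver-⊤ (replicate n w))) (trans (sumOver-replicate (⊤ {n}) w) (cong (w ℕ.*_) (∣⊤∣≡n n)))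

sumOver-empty : ∀ (S : Subset n) x → (∀ i → lookup S i ≢ true) → sumOver S x ≡ 0
sumOver-empty []          []      _  = refl
sumOver-empty (true ∷ S)  (x ∷ v) em = contradiction refl (em zero)
sumOver-empty (false ∷ S) (x ∷ v) em = sumOver-empty S v (λ i → em (suc i))

card>0 : ∀ (S : Subset n) i → lookup S i ≡ true → 0 ℕ.< card S
card>0 (true ∷ S)  _       _ = s≤s z≤n
card>0 (false ∷ S) (suc i) p = card>0 S i p

inhabited? : ∀ (S : Subset n) → (∃ λ i → lookup S i ≡ true) ⊎ (∀ i → lookup S i ≢ true)
inhabited? S with FinP.any? (λ i → lookup S i BoolP.≟ true)
... | yes p = inj₁ p
... | no ¬p = inj₂ λ i q → ¬p (i , q)

-- Draconian sequences of a bipartite graph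

-- Stated for an arbitrary list of arcs, so that it applies to a tree inside D(G) as well as to D(G)
-- itself. Letting `B` range over all sets containing the neighbours of `S` matches the form of
-- Gale's condition.
record Dragon (es : List (Arc n)) (a : Vec ℕ n) : Set where
  field
    total    : suc (sumℕ a) ≡ n
    marriage : ∀ S B i → lookup S i ≡ true → Closed es S B → sumOver S a ℕ.< card B

ones : ∀ k → Vec ℕ k
ones k = replicate k 1

-- The strict inequality leaves room in every cut for the one extra unit at row `l`.
dragon-matching : ∀ (es : List (Arc n)) {a} → Dragon es a → ∀ l →
                  Σ (Vec ℕ (length es)) λ W → Good es W × HasMargins es W (updateAt a l suc) (ones n)
dragon-matching {n} es {a} D l = transport es record
  { balanced = trans (sumℕ-updateAt a l 1) (trans total (sym (trans (sumℕ-replicate n 1) (ℕP.*-identityˡ n))))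
  ; cut = cut
  }
  where
  open Dragon D
  ≤1+ : ∀ b m → (if b then 1 else 0) ℕ.+ m ≤ suc m
  ≤1+ true  m = ℕP.≤-refl
  ≤1+ false m = ℕP.n≤1+n m
  cut : ∀ S B → Closed es S B → sumOver S (updateAt a l suc) ≤ sumOver B (ones n)
  cut S B c with inhabited? S
  ... | inj₂ em      = subst (ℕ._≤ sumOver B (ones n)) (sym (sumOver-empty S (updateAt a l suc) em)) z≤n
  ... | inj₁ (i , p) = subst₂ _≤_ (sym (sumOver-updateAt S a l 1)) (sym (trans (sumOver-replicate B 1) (ℕP.*-identityˡ (card B))))
    (ℕP.≤-trans (≤1+ (lookup S l) (sumOver S a)) (marriage S B i p c))

-- The point (n a + 1, n 1) is the sum over l of the margins (a + e_l, 1).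
inner : ∀ n → Vec ℕ n → Vec ℕ n
inner n = Vec.map (λ a → suc (n ℕ.* a))

sumOver-inner : ∀ m (S : Subset n) a → sumOver S (Vec.map (λ x → suc (m ℕ.* x)) a) ≡ m ℕ.* sumOver S a ℕ.+ card S
sumOver-inner m []          []      = sym (trans (ℕP.+-identityʳ (m ℕ.* 0)) (ℕP.*-zeroʳ m))
sumOver-inner m (false ∷ S) (x ∷ a) = sumOver-inner m S a
sumOver-inner m (true ∷ S)  (x ∷ a) = trans (cong (λ v → suc (m ℕ.* x ℕ.+ v)) (sumOver-inner m S a))
  (trans (cong suc (sym (ℕP.+-assoc (m ℕ.* x) (m ℕ.* sumOver S a) (card S))))
    (trans (sym (ℕP.+-suc _ (card S))) (cong (ℕ._+ suc (card S)) (sym (ℕP.*-distribˡ-+ m x (sumOver S a))))))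

-- Multiplied by `n`, the strict inequality has slack `n`, and the additional ones in the rows of
-- `S` cost only `card S ≤ n`.
dragon⇒inner : ∀ (es : List (Arc n)) {a} → Dragon es a → Transportable es (inner n a) (replicate n n)
dragon⇒inner {n} es {a} D = record
  { balanced = trans (sym (sumOver-⊤ (inner n a))) (trans (sumOver-inner n ⊤ a)
      (trans (cong₂ (λ u v → n ℕ.* u ℕ.+ v) (sumOver-⊤ a) (∣⊤∣≡n n))
        (trans (ℕP.+-comm (n ℕ.* sumℕ a) n) (trans (sym (ℕP.*-suc n (sumℕ a))) (trans (cong (n ℕ.*_) total) (sym (sumℕ-replicate n n)))))))
  ; cut = cut
  }
  where
  open Dragon D
  cut : ∀ S B → Closed es S B → sumOver S (inner n a) ≤ sumOver B (replicate n n)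
  cut S B c with inhabited? S
  ... | inj₂ em      = subst (ℕ._≤ sumOver B (replicate n n)) (sym (sumOver-empty S (inner n a) em)) z≤n
  ... | inj₁ (i , p) = subst₂ _≤_ (sym (sumOver-inner n S a)) (sym (sumOver-replicate B n))
    (ℕP.≤-trans (ℕP.+-monoʳ-≤ (n ℕ.* sumOver S a) (∣p∣≤n S))
      (ℕP.≤-trans (ℕP.≤-reflexive (trans (ℕP.+-comm (n ℕ.* sumOver S a) n) (sym (ℕP.*-suc n (sumOver S a)))))
        (ℕP.*-monoʳ-≤ n (marriage S B i p c))))

-- The additional ones contribute `card S > 0`, which makes the inequality strict after division by
-- `n`.
inner⇒dragon : ∀ (es : List (Arc n)) {a} → suc (sumℕ a) ≡ n → Transportable es (inner n a) (replicate n n) → Dragon es a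
inner⇒dragon {n} es {a} tot T = record
  { total = tot
  ; marriage = λ S B i p c → ℕP.*-cancelˡ-< n (sumOver S a) (card B)
      (ℕP.<-≤-trans (ℕP.m<m+n (n ℕ.* sumOver S a) (card>0 S i p))
        (subst₂ _≤_ (sumOver-inner n S a) (sumOver-replicate B n) (cut S B c)))
  }
  where open Transportable T

-- Comparing weightings entrywise and by margins

margin-entry : ∀ (π : Arc n → Fin n) e es w W i → lookup (margin π (e ∷ es) (w ∷ W)) i ≡
               (if ⌊ π e Fin.≟ i ⌋ then w else 0) ℕ.+ lookup (margin π es W) i
margin-entry π e es w W i with π e Fin.≟ i
... | yes refl = VecP.lookup∘updateAt (π e) (margin π es W)
... | no ne    = VecP.lookup∘updateAt′ i (π e) (λ eq → ne (sym eq)) (margin π es W)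

entry≤margin : ∀ (π : Arc n → Fin n) es W k → lookup W k ≤ lookup (margin π es W) (π (List.lookup es k))
entry≤margin π (e ∷ es) (w ∷ W) zero    = subst (w ≤_) (sym (VecP.lookup∘updateAt (π e) (margin π es W))) (ℕP.m≤m+n w _)
entry≤margin π (e ∷ es) (w ∷ W) (suc k) = ℕP.≤-trans (entry≤margin π es W k)
  (subst (lookup (margin π es W) (π (List.lookup es k)) ≤_) (sym (margin-entry π e es w W (π (List.lookup es k)))) (ℕP.m≤n+m _ _))

if-mono : ∀ b {v w} → v ≤ w → (if b then v else 0) ≤ (if b then w else 0)
if-mono true  p = p
if-mono false _ = z≤n

margin-mono : ∀ (π : Arc n → Fin n) es V W → (∀ k → lookup V k ≤ lookup W k) →
              ∀ i → lookup (margin π es V) i ≤ lookup (margin π es W) i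
margin-mono π []       []      []      le i = ℕP.≤-refl
margin-mono π (e ∷ es) (v ∷ V) (w ∷ W) le i =
  subst₂ _≤_ (sym (margin-entry π e es v V i)) (sym (margin-entry π e es w W i))
    (ℕP.+-mono-≤ (if-mono ⌊ π e Fin.≟ i ⌋ (le zero)) (margin-mono π es V W (λ k → le (suc k)) i))

+-equal : ∀ {a b c d} → a ≤ b → c ≤ d → a ℕ.+ c ≡ b ℕ.+ d → a ≡ b × c ≡ d
+-equal {a} {b} {c} {d} p q eq with a ℕP.≟ b
... | yes refl = refl , ℕP.+-cancelˡ-≡ a c d eq
... | no ne    = contradiction eq (ℕP.<⇒≢ (ℕP.+-mono-<-≤ (ℕP.≤∧≢⇒< p ne) q))

margin-equal : ∀ (π : Arc n → Fin n) es V W i → (∀ k → lookup V k ≤ lookup W k) →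
               lookup (margin π es V) i ≡ lookup (margin π es W) i →
               ∀ k → π (List.lookup es k) ≡ i → lookup V k ≡ lookup W k
margin-equal π (e ∷ es) (v ∷ V) (w ∷ W) i le eq k at
  with +-equal (if-mono ⌊ π e Fin.≟ i ⌋ (le zero)) (margin-mono π es V W (λ k → le (suc k)) i)
         (trans (sym (margin-entry π e es v V i)) (trans eq (margin-entry π e es w W i)))
margin-equal π (e ∷ es) (v ∷ V) (w ∷ W) i le eq (suc k) at | _ , rest = margin-equal π es V W i (λ k → le (suc k)) rest k at
margin-equal π (e ∷ es) (v ∷ V) (w ∷ W) i le eq zero    at | hd , _ with π e Fin.≟ i
... | yes _ = hd
... | no ne = contradiction at ne

sum-mono : ∀ (x y : Vec ℕ k) → (∀ i → lookup x i ≤ lookup y i) → sumℕ x ≤ sumℕ y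
sum-mono []      []      _  = z≤n
sum-mono (x ∷ v) (y ∷ u) le = ℕP.+-mono-≤ (le zero) (sum-mono v u (λ i → le (suc i)))

sum-equal : ∀ (x y : Vec ℕ k) → (∀ i → lookup x i ≤ lookup y i) → sumℕ y ≤ sumℕ x → x ≡ y
sum-equal []      []      _  _  = refl
sum-equal (x ∷ v) (y ∷ u) le ge
  with +-equal (le zero) (sum-mono v u (λ i → le (suc i))) (ℕP.≤-antisym (ℕP.+-mono-≤ (le zero) (sum-mono v u (λ i → le (suc i)))) ge)
... | refl , eq = cong (x ∷_) (sum-equal v u (λ i → le (suc i)) (ℕP.≤-reflexive (sym eq)))

sumℕ-map-suc : ∀ (a : Vec ℕ k) → sumℕ (Vec.map suc a) ≡ k ℕ.+ sumℕ a
sumℕ-map-suc []      = refl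
sumℕ-map-suc {suc k} (x ∷ a) = cong suc (trans (cong (x ℕ.+_) (sumℕ-map-suc a)) (x∙yz≈y∙xz x k (sumℕ a)))

sumOver-map-suc : ∀ S (a : Vec ℕ k) → sumOver S (Vec.map suc a) ≡ card S ℕ.+ sumOver S a
sumOver-map-suc []          []      = refl
sumOver-map-suc (false ∷ S) (x ∷ a) = sumOver-map-suc S a
sumOver-map-suc (true ∷ S)  (x ∷ a) = cong suc (trans (cong (x ℕ.+_) (sumOver-map-suc S a)) (x∙yz≈y∙xz x (card S) (sumOver S a)))

sumℕ-indicator : ∀ (F : Subset k) → sumℕ (indicator F) ≡ card F
sumℕ-indicator []          = refl
sumℕ-indicator (true ∷ F)  = cong suc (sumℕ-indicator F)
sumℕ-indicator (false ∷ F) = sumℕ-indicator F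

supported-lookup : ∀ {W : Vec ℕ k} {F} → SupportedIn W F → ∀ i → lookup F i ≡ false → lookup W i ≡ 0
supported-lookup (s ∷ ss) zero    p = s p
supported-lookup (s ∷ ss) (suc i) p = supported-lookup ss i p

-- An entry is at most its column sum, which is 1, so the weighting is a 0/1 matrix.
≤indicator : ∀ (es : List (Arc n)) {W F x} → SupportedIn W F → HasMargins es W x (ones n) → ∀ k → lookup W k ≤ lookup (indicator F) k
≤indicator es {W} {F} s (_ , cols) k
  rewrite VecP.lookup-map k (λ b → if b then 1 else 0) F with lookup F k in eq
... | false = ℕP.≤-reflexive (supported-lookup s k eq)
... | true  = ℕP.≤-trans (entry≤margin proj₂ es W k) (ℕP.≤-reflexive (trans (cong (λ v → lookup v (proj₂ (List.lookup es k))) cols)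
                (VecP.lookup-replicate (proj₂ (List.lookup es k)) 1)))

-- Good spanning trees and draconian sequences

degrees : (es : List (Arc n)) → Subset (length es) → Vec ℕ n
degrees es F = margin proj₁ es (indicator F)

sumℕ-degrees : ∀ (es : List (Arc n)) F → sumℕ (degrees es F) ≡ card F
sumℕ-degrees es F = trans (sumℕ-margin proj₁ es (indicator F)) (sumℕ-indicator F)

restrict : ∀ (xs : List A) F {W} → SupportedIn W F → Σ (Vec ℕ (length (select xs F))) λ V → extend 0 (select-⊑ xs F) V ≡ W
restrict []       []          []       = [] , refl
restrict (x ∷ xs) (true ∷ F)  {w ∷ W} (s ∷ ss) = let V , eq = restrict xs F ss in w ∷ V , cong (w ∷_) eq
restrict (x ∷ xs) (false ∷ F) (s ∷ ss) = let V , eq = restrict xs F ss in V , cong₂ _∷_ (sym (s refl)) eq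

record Matching (es : List (Arc n)) (F : Subset (length es)) (a : Vec ℕ n) (l : Fin n) : Set where
  field
    W         : Vec ℕ (length es)
    supported : SupportedIn W F
    margins   : HasMargins es W (updateAt a l suc) (ones n)

matching : ∀ (es : List (Arc n)) F {a} → Dragon (select es F) a → ∀ l → Matching es F a l
matching es F D l with dragon-matching (select es F) D l
... | W , _ , rows , cols = record
  { W = extend 0 (select-⊑ es F) W
  ; supported = supported-extend es F W
  ; margins = trans (margin-extend proj₁ (select-⊑ es F) W) rows , trans (margin-extend proj₂ (select-⊑ es F) W) cols
  }

record SpanningTree (es : List (Arc n)) (F : Subset (length es)) : Set where
  constructor spanningTree
  field
    good : GoodSet es F
    size : suc (card F) ≡ n ℕ.+ n

lookup-⊤ : ∀ (i : Fin n) → lookup ⊤ i ≡ true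
lookup-⊤ i = VecP.lookup-replicate i true

independent-size : ∀ (es : List (Arc (suc n))) → Independent es → length es ℕ.< suc n ℕ.+ suc n
independent-size {n} es ind = subst (length es ℕ.<_) (cong₂ ℕ._+_ (∣⊤∣≡n (suc n)) (∣⊤∣≡n (suc n)))
  (independent-bound es ⊤ ⊤ zero refl (All.universal (λ e → lookup-⊤ (proj₁ e) , lookup-⊤ (proj₂ e)) es) ind)

goodSet-size : ∀ (es : List (Arc (suc n))) F → GoodSet es F → card F ℕ.< suc n ℕ.+ suc n
goodSet-size es F G = subst (ℕ._< _) (length-select es F) (independent-size (select es F) (goodSet-independent es G))

-- The support F satisfies the draconian inequalities by itself, so for each l it carries a 0/1
-- matrix with row sums a + e_l; hence row l has degree at least a_l + 1. These lower bounds add up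
-- to 2n - 1, the largest size of a forest, so all of them are equalities.
dragon⇒tree : ∀ (es : List (Arc n)) {a} → Dragon es a →
              Σ (Subset (length es)) λ F → SpanningTree es F × degrees es F ≡ Vec.map suc a
dragon⇒tree {zero}  es D with () ← Dragon.total D
dragon⇒tree {n@(suc _)} es {a} D with transport es (dragon⇒inner es D)
... | M , goodM , rowsM , colsM = F , spanningTree goodF (ℕP.≤-antisym (goodSet-size es F goodF) bigF) ,
      sym (sum-equal (Vec.map suc a) (degrees es F) deg≥
        (ℕP.≤-trans (ℕP.≤-reflexive (sumℕ-degrees es F)) (ℕP.≤-pred (ℕP.≤-trans (goodSet-size es F goodF) (ℕP.≤-reflexive (sym sumA))))))
  where
  F = support M
  goodF : GoodSet es F
  goodF = goodSet-support es goodM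
  -- The matrix lives on F, so the inner point is transportable within F, and this gives back the
  -- inequalities with neighbours taken in F only.
  dragonF : Dragon (select es F) a
  dragonF with restrict es F (supported-support M)
  ... | V , eq = inner⇒dragon (select es F) (Dragon.total D) (hasMargins⇒transportable (select es F)
      (trans (sym (margin-extend proj₁ (select-⊑ es F) V)) (trans (cong (margin proj₁ es) eq) rowsM) ,
       trans (sym (margin-extend proj₂ (select-⊑ es F) V)) (trans (cong (margin proj₂ es) eq) colsM)))
  deg≥ : ∀ i → lookup (Vec.map suc a) i ≤ lookup (degrees es F) i
  deg≥ i = let open Matching (matching es F dragonF i) in
    subst (ℕ._≤ lookup (degrees es F) i) (trans (cong (λ v → lookup v i) (proj₁ margins)) (trans (VecP.lookup∘updateAt i a) (sym (VecP.lookup-map i suc a))))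
      (margin-mono proj₁ es W (indicator F) (≤indicator es supported margins) i)
  sumA : suc (sumℕ (Vec.map suc a)) ≡ n ℕ.+ n
  sumA = trans (cong suc (sumℕ-map-suc a)) (trans (sym (ℕP.+-suc n (sumℕ a))) (cong (n ℕ.+_) (Dragon.total D)))
  bigF : n ℕ.+ n ≤ suc (card F)
  bigF = ℕP.≤-trans (ℕP.≤-reflexive (sym sumA))
    (s≤s (ℕP.≤-trans (sum-mono (Vec.map suc a) (degrees es F) deg≥) (ℕP.≤-reflexive (sumℕ-degrees es F))))

extend-ones : ∀ (xs : List A) F → extend 0 (select-⊑ xs F) (ones _) ≡ indicator F
extend-ones []       []          = refl
extend-ones (x ∷ xs) (true ∷ F)  = cong (1 ∷_) (extend-ones xs F)
extend-ones (x ∷ xs) (false ∷ F) = cong (0 ∷_) (extend-ones xs F)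

degrees-select : ∀ (es : List (Arc n)) F → margin proj₁ (select es F) (ones _) ≡ degrees es F
degrees-select es F = trans (sym (margin-extend proj₁ (select-⊑ es F) (ones _))) (cong (margin proj₁ es) (extend-ones es F))

leaving : Subset n → List (Arc n) → List (Arc n)
leaving S = filterᵇ (λ e → lookup S (proj₁ e))

leaving-⊑ : ∀ S (es : List (Arc n)) → leaving S es ⊑ es
leaving-⊑ S []       = []
leaving-⊑ S (e ∷ es) with lookup S (proj₁ e)
... | true  = refl ∷ leaving-⊑ S es
... | false = e ∷ʳ leaving-⊑ S es

length-leaving : ∀ S (es : List (Arc n)) → length (leaving S es) ≡ sumOver S (margin proj₁ es (ones _))
length-leaving {n} S []   = sym (trans (sumOver-replicate S 0) refl)
length-leaving S (e ∷ es) = trans (go (length-leaving S es)) (sym (sumOver-updateAt S (margin proj₁ es (ones _)) (proj₁ e) 1))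
  where
  go : ∀ {m} → length (leaving S es) ≡ m → length (leaving S (e ∷ es)) ≡ (if lookup S (proj₁ e) then 1 else 0) ℕ.+ m
  go eq with lookup S (proj₁ e)
  ... | true  = cong suc eq
  ... | false = eq

leaving-within : ∀ S B (es : List (Arc n)) → Closed es S B → All (Within S B) (leaving S es)
leaving-within S B []       []                = []
leaving-within S B (e ∷ es) (respects r ∷ rs) with lookup S (proj₁ e) in p
... | false = leaving-within S B es rs
... | true  = (p , BoolP.≤-antisym (BoolP.≤-maximum _) r) ∷ leaving-within S B es rs

outside-of-zero : ∀ (es : List (Arc n)) i → lookup (margin proj₁ es (ones _)) i ≡ 0 → All (λ e → proj₁ e ≢ i) es
outside-of-zero []       i z = []
outside-of-zero (e ∷ es) i z with trans (sym (margin-entry proj₁ e es 1 (ones _) i)) z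
... | eq with proj₁ e Fin.≟ i
...   | no ne = ne ∷ outside-of-zero es i eq
...   | yes _ with () ← eq

treeDragon : (es : List (Arc n)) → Subset (length es) → Vec ℕ n
treeDragon es F = Vec.map ℕ.pred (degrees es F)

module _ {n} (es : List (Arc n)) {F} (T : SpanningTree es F) where
  open SpanningTree T

  private
    fs = select es F
    ind : Independent fs
    ind = goodSet-independent es good
    size-fs : suc (length fs) ≡ n ℕ.+ n
    size-fs = trans (cong suc (length-select es F)) size

  -- A tree avoiding row `i` would be a forest on n - 1 rows and n columns, too small for 2n - 1
  -- arcs.
  degrees>0 : ∀ i → lookup (degrees es F) i ≢ 0
  degrees>0 i z with outside-of-zero fs i (trans (cong (λ v → lookup v i) (degrees-select es F)) z)
  ... | avoid = contradiction (subst (ℕ._≤ card (⊤ without i) ℕ.+ n) size-fs (bound fs avoid size-fs ind))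
                  (ℕP.<⇒≱ (ℕP.+-monoˡ-< n (subst (card (⊤ without i) ℕ.<_) (∣⊤∣≡n n) (x∈p⇒∣p-x∣<∣p∣ (∈⊤ {x = i})))))
    where
    inside : ∀ {j} → j ≢ i → lookup (⊤ without i) j ≡ true
    inside ne = VecP.[]=⇒lookup (x∈p∧x≢y⇒x∈p-y ∈⊤ ne)
    -- The forest bound needs a row that lies in the row set, taken from the first arc; an empty
    -- list is excluded by parity, as it would give 1 = n + n.
    notOne : ∀ {m} → Fin m → 1 ≢ m ℕ.+ m
    notOne {suc m} _ eq = contradiction (trans eq (cong suc (ℕP.+-suc m m))) λ ()
    bound : ∀ gs → All (λ e → proj₁ e ≢ i) gs → suc (length gs) ≡ n ℕ.+ n → Independent gs → suc (length gs) ≤ card (⊤ without i) ℕ.+ n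
    bound []          _          len _ = contradiction len (notOne i)
    bound gs@(g ∷ _)  (ne ∷ nes) _ indep = subst (λ m → length gs ℕ.< card (⊤ without i) ℕ.+ m) (∣⊤∣≡n n)
      (independent-bound gs (⊤ without i) ⊤ (proj₁ g) (inside ne) (All.map (λ {e} q → inside q , lookup-⊤ (proj₂ e)) (ne ∷ nes)) indep)

  degrees-suc : degrees es F ≡ Vec.map suc (treeDragon es F)
  degrees-suc = vec-ext λ i → sym (trans (VecP.lookup-map i suc (treeDragon es F))
    (trans (cong suc (VecP.lookup-map i ℕ.pred (degrees es F))) (suc-pred (degrees>0 i))))
    where
    suc-pred : ∀ {m} → m ≢ 0 → suc (ℕ.pred m) ≡ m
    suc-pred {zero}  ne = contradiction refl ne
    suc-pred {suc m} _  = refl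

  -- The tree arcs leaving `S` form a forest within `S` and `B`, so there are fewer than
  -- `card S + card B` of them; by degrees their number is `card S` plus the sum of the sequence
  -- over `S`.
  tree⇒dragon : Dragon fs (treeDragon es F)
  tree⇒dragon = record { total = tot ; marriage = marriage }
    where
    tot : suc (sumℕ (treeDragon es F)) ≡ n
    tot = ℕP.+-cancelˡ-≡ n _ _ (trans (ℕP.+-suc n _) (trans (cong suc (trans (sym (sumℕ-map-suc (treeDragon es F)))
      (trans (cong sumℕ (sym degrees-suc)) (sumℕ-degrees es F)))) size))
    marriage : ∀ S B i → lookup S i ≡ true → Closed fs S B → sumOver S (treeDragon es F) ℕ.< card B
    marriage S B i p c = ℕP.+-cancelˡ-< (card S) _ _ (subst (ℕ._< card S ℕ.+ card B)
      (trans (length-leaving S fs) (trans (cong (sumOver S) (trans (degrees-select es F) degrees-suc)) (sumOver-map-suc S (treeDragon es F))))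
      (independent-bound (leaving S fs) S B i p (leaving-within S B fs c) (independent-⊑ (leaving-⊑ S fs) ind)))

closed-⊑ : ∀ {fs es : List (Arc n)} {S B} → fs ⊑ es → Closed es S B → Closed fs S B
closed-⊑ []         []       = []
closed-⊑ (e ∷ʳ τ)   (_ ∷ rs) = closed-⊑ τ rs
closed-⊑ (refl ∷ τ) (r ∷ rs) = r ∷ closed-⊑ τ rs

dragon-⊑ : ∀ {fs es : List (Arc n)} {a} → fs ⊑ es → Dragon fs a → Dragon es a
dragon-⊑ τ D = record { total = total ; marriage = λ S B i p c → marriage S B i p (closed-⊑ τ c) }
  where open Dragon D

-- The good matrix with margins (a + e_i, 1) uses every arc of the tree at i, and it is determined by a.
tree-unique : ∀ (es : List (Arc n)) {F F′} → SpanningTree es F → SpanningTree es F′ →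
              treeDragon es F ≡ treeDragon es F′ → F ≡ F′
tree-unique es {F} {F′} T T′ same =
  trans (sym (support-indicator F)) (trans (cong support (vec-ext agree)) (support-indicator F′))
  where
  uses : ∀ {G} (U : SpanningTree es G) k →
         lookup (Matching.W (matching es G (tree⇒dragon es U) (proj₁ (List.lookup es k)))) k ≡ lookup (indicator G) k
  uses {G} U k = margin-equal proj₁ es W (indicator G) i (≤indicator es supported margins)
      (trans (cong (λ v → lookup v i) (proj₁ margins)) (trans (VecP.lookup∘updateAt i a)
        (sym (trans (cong (λ v → lookup v i) (degrees-suc es U)) (VecP.lookup-map i suc a))))) k refl
    where
    i = proj₁ (List.lookup es k)
    a = treeDragon es G
    open Matching (matching es G (tree⇒dragon es U) i)
  agree : ∀ k → lookup (indicator F) k ≡ lookup (indicator F′) k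
  agree k = trans (sym (uses T k)) (trans (cong (λ V → lookup V k) (good-unique es
      (good-supported es (SpanningTree.good T) (supported M)) (good-supported es (SpanningTree.good T′) (supported M′))
      (margins M) (subst (λ a → HasMargins es (W M′) (updateAt a i suc) (ones _)) (sym same) (margins M′)))) (uses T′ k))
    where
    open Matching
    i = proj₁ (List.lookup es k)
    M = matching es F (tree⇒dragon es T) i
    M′ = matching es F′ (tree⇒dragon es T′) i

-- Enumeration of good supports, trees and draconian sequences

unique-map : {f : A → B} {xs : List A} → (∀ {x y} → x ∈ xs → y ∈ xs → f x ≡ f y → x ≡ y) → Unique xs → Unique (map f xs)
unique-map inj []       = []
unique-map inj (x∉ ∷ u) = AllP.map⁺ (All.tabulate λ m eq → All.lookup x∉ m (inj (here refl) (there m) eq))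
                        ∷ unique-map (λ p q → inj (there p) (there q)) u

subsets : ∀ k → List (Subset k)
subsets zero    = [] ∷ []
subsets (suc k) = map (true ∷_) (subsets k) ++ map (false ∷_) (subsets k)

∈-subsets : ∀ (F : Subset k) → F ∈ subsets k
∈-subsets []          = here refl
∈-subsets (true ∷ F)  = ∈-++⁺ˡ (∈-map⁺ (true ∷_) (∈-subsets F))
∈-subsets (false ∷ F) = ∈-++⁺ʳ (map (true ∷_) (subsets _)) (∈-map⁺ (false ∷_) (∈-subsets F))

unique-subsets : ∀ k → Unique (subsets k)
unique-subsets zero    = [] ∷ []
unique-subsets (suc k) = UniqueP.++⁺ (UniqueP.map⁺ VecP.∷-injectiveʳ (unique-subsets k)) (UniqueP.map⁺ VecP.∷-injectiveʳ (unique-subsets k)) disj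
  where
  disj : Disjoint (map (true ∷_) (subsets k)) (map (false ∷_) (subsets k))
  disj (p , q) with ∈-map⁻ (true ∷_) p | ∈-map⁻ (false ∷_) q
  ... | _ , _ , refl | _ , _ , ()

-- F is good exactly when the good weighting with the margins of its indicator is the indicator itself.
abstract
  goodSet? : ∀ (es : List (Arc n)) F → Dec (GoodSet es F)
  goodSet? es F with transport es (hasMargins⇒transportable es {indicator F} (refl , refl))
  ... | V , good , margins with VecP.≡-dec ℕP._≟_ V (indicator F)
  ...   | yes refl = yes good
  ...   | no V≢F   = no λ G → V≢F (good-unique es good G margins (refl , refl))

goodSets : (es : List (Arc n)) → List (Subset (length es))
goodSets es = filter (goodSet? es) (subsets (length es))

unique-goodSets : ∀ (es : List (Arc n)) → Unique (goodSets es)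
unique-goodSets es = UniqueP.filter⁺ (goodSet? es) (unique-subsets (length es))

∈-goodSets : ∀ (es : List (Arc n)) {F} → GoodSet es F → F ∈ goodSets es
∈-goodSets es {F} G = ∈-filter⁺ (goodSet? es) (∈-subsets F) G

goodSets-good : ∀ (es : List (Arc n)) {F} → F ∈ goodSets es → GoodSet es F
goodSets-good es m = proj₂ (∈-filter⁻ (goodSet? es) {xs = subsets (length es)} m)

hasSize? : ∀ m (F : Subset k) → Dec (suc (card F) ≡ m)
hasSize? m F = suc (card F) ℕP.≟ m

trees : (es : List (Arc n)) → List (Subset (length es))
trees {n} es = filter (hasSize? (n ℕ.+ n)) (goodSets es)

trees-spanning : ∀ (es : List (Arc n)) {F} → F ∈ trees es → SpanningTree es F
trees-spanning {n} es m =
  let g , s = ∈-filter⁻ (hasSize? (n ℕ.+ n)) {xs = goodSets es} m in spanningTree (goodSets-good es g) s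

dragons : (es : List (Arc n)) → List (Vec ℕ n)
dragons es = map (treeDragon es) (trees es)

unique-dragons : ∀ (es : List (Arc n)) → Unique (dragons es)
unique-dragons {n} es = unique-map (λ p q → tree-unique es (trees-spanning es p) (trees-spanning es q))
  (UniqueP.filter⁺ (hasSize? (n ℕ.+ n)) (unique-goodSets es))

∈-dragons⇒dragon : ∀ (es : List (Arc n)) {a} → a ∈ dragons es → Dragon es a
∈-dragons⇒dragon es m with ∈-map⁻ (treeDragon es) m
... | F , F∈ , refl = dragon-⊑ (select-⊑ es F) (tree⇒dragon es (trees-spanning es F∈))

dragon⇒∈-dragons : ∀ (es : List (Arc n)) {a} → Dragon es a → a ∈ dragons es
dragon⇒∈-dragons {n} es {a} D with dragon⇒tree es D
... | F , T , deg = subst (_∈ dragons es)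
  (trans (cong (Vec.map ℕ.pred) deg) (trans (sym (VecP.map-∘ ℕ.pred suc a)) (VecP.map-id a)))
  (∈-map⁺ (treeDragon es) (∈-filter⁺ (hasSize? (n ℕ.+ n)) (∈-goodSets es (SpanningTree.good T)) (SpanningTree.size T)))

-- Weightings with a prescribed support

bump : Vec ℕ (suc k) → Vec ℕ (suc k)
bump (w ∷ W) = suc w ∷ W

-- The support is exactly `F`: a positive head is either 1 or one more than a positive head, which
-- is Pascal's recursion.
weightings : Subset k → ℕ → List (Vec ℕ k)
weightings []          zero    = [] ∷ []
weightings []          (suc t) = []
weightings (false ∷ F) t       = map (0 ∷_) (weightings F t)
weightings (true ∷ F)  zero    = []
weightings (true ∷ F)  (suc t) = map (1 ∷_) (weightings F t) ++ map bump (weightings (true ∷ F) t)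

weightings-sound : ∀ (F : Subset k) t {W} → W ∈ weightings F t → support W ≡ F × sumℕ W ≡ t
weightings-sound []          zero    (here refl) = refl , refl
weightings-sound (false ∷ F) t       m with ∈-map⁻ (0 ∷_) m
... | W , W∈ , refl = let s , e = weightings-sound F t W∈ in cong (false ∷_) s , e
weightings-sound (true ∷ F)  (suc t) m with ∈-++⁻ (map (1 ∷_) (weightings F t)) m
... | inj₁ m₁ with ∈-map⁻ (1 ∷_) m₁
...   | W , W∈ , refl = let s , e = weightings-sound F t W∈ in cong (true ∷_) s , cong suc e
weightings-sound (true ∷ F)  (suc t) m | inj₂ m₂ with ∈-map⁻ bump m₂
...   | w ∷ W , W∈ , refl = let s , e = weightings-sound (true ∷ F) t W∈ in cong (true ∷_) (VecP.∷-injectiveʳ s) , cong suc e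

weightings-complete : ∀ (W : Vec ℕ k) → W ∈ weightings (support W) (sumℕ W)
weightings-complete []                = here refl
weightings-complete (zero ∷ W)        = ∈-map⁺ (0 ∷_) (weightings-complete W)
weightings-complete (suc zero ∷ W)    = ∈-++⁺ˡ (∈-map⁺ (1 ∷_) (weightings-complete W))
weightings-complete (suc (suc w) ∷ W) = ∈-++⁺ʳ (map (1 ∷_) (weightings (support W) (suc w ℕ.+ sumℕ W))) (∈-map⁺ bump (weightings-complete (suc w ∷ W)))

unique-weightings : ∀ (F : Subset k) t → Unique (weightings F t)
unique-weightings []          zero    = [] ∷ []
unique-weightings []          (suc t) = []
unique-weightings (false ∷ F) t       = UniqueP.map⁺ VecP.∷-injectiveʳ (unique-weightings F t)
unique-weightings (true ∷ F)  zero    = []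
unique-weightings (true ∷ F)  (suc t) =
  UniqueP.++⁺ (UniqueP.map⁺ VecP.∷-injectiveʳ (unique-weightings F t)) (UniqueP.map⁺ bump-injective (unique-weightings (true ∷ F) t)) disj
  where
  bump-injective : ∀ {V W : Vec ℕ (suc k)} → bump V ≡ bump W → V ≡ W
  bump-injective {V = v ∷ V} {w ∷ W} refl = refl
  disj : Disjoint (map (1 ∷_) (weightings F t)) (map bump (weightings (true ∷ F) t))
  disj (p , q) with ∈-map⁻ (1 ∷_) p | ∈-map⁻ bump q
  ... | V , _ , refl | zero ∷ W , W∈ , eq with () ← proj₁ (weightings-sound (true ∷ F) t W∈)

-- Compositions of `t` into `k` positive parts; for positive `k` and `t` this is the binomial
-- coefficient of t - 1 over k - 1.
compositions : ℕ → ℕ → ℕ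
compositions zero    zero    = 1
compositions zero    (suc t) = 0
compositions (suc k) zero    = 0
compositions (suc k) (suc t) = compositions k t ℕ.+ compositions (suc k) t

length-weightings : ∀ (F : Subset k) t → length (weightings F t) ≡ compositions (card F) t
length-weightings []          zero    = refl
length-weightings []          (suc t) = refl
length-weightings (false ∷ F) t       = trans (ListP.length-map (0 ∷_) (weightings F t)) (length-weightings F t)
length-weightings (true ∷ F)  zero    = refl
length-weightings (true ∷ F)  (suc t) = trans (ListP.length-++ (map (1 ∷_) (weightings F t)))
  (cong₂ ℕ._+_ (trans (ListP.length-map (1 ∷_) (weightings F t)) (length-weightings F t))
    (trans (ListP.length-map bump (weightings (true ∷ F) t)) (length-weightings (true ∷ F) t)))

goodWeightings : (es : List (Arc n)) → ℕ → List (Vec ℕ (length es))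
goodWeightings es t = concatMap (λ F → weightings F t) (goodSets es)

∈-goodWeightings : ∀ (es : List (Arc n)) {W} → Good es W → W ∈ goodWeightings es (sumℕ W)
∈-goodWeightings es {W} G = ∈-concatMap⁺ (λ F → weightings F (sumℕ W)) (lose (∈-goodSets es (goodSet-support es G)) (weightings-complete W))

goodWeightings-sound : ∀ (es : List (Arc n)) t {W} → W ∈ goodWeightings es t → Good es W × sumℕ W ≡ t
goodWeightings-sound es t {W} m with find (∈-concatMap⁻ (λ F → weightings F t) {goodSets es} m)
... | F , F∈ , W∈ with weightings-sound F t W∈
...   | refl , e = good-supported es (goodSets-good es F∈) (supported-support W) , e

unique-goodWeightings : ∀ (es : List (Arc n)) t → Unique (goodWeightings es t)
unique-goodWeightings es t = UniqueP.concat⁺ (AllP.map⁺ (All.universal (λ F → unique-weightings F t) (goodSets es)))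
  (AllPairsP.map⁺ (AllPairs.map disj (unique-goodSets es)))
  where
  disj : ∀ {F F′} → F ≢ F′ → Disjoint (weightings F t) (weightings F′ t)
  disj {F} {F′} ne (p , q) = ne (trans (sym (proj₁ (weightings-sound F t p))) (proj₁ (weightings-sound F′ t q)))

-- Asymptotics of the number of compositions

compositions-1 : ∀ t → compositions 1 (suc t) ≡ 1
compositions-1 zero    = refl
compositions-1 (suc t) = compositions-1 t

-- The identity (k + 1) C(t, k + 1) = (t - k) C(t, k) for binomial coefficients, with the
-- subtraction moved to the other side.
absorption : ∀ k t → suc k ℕ.* compositions (suc (suc k)) (suc t) ℕ.+ k ℕ.* compositions (suc k) (suc t) ≡ t ℕ.* compositions (suc k) (suc t)
absorption zero    zero    = refl
absorption (suc k) zero    = trans (cong₂ ℕ._+_ (ℕP.*-zeroʳ (suc (suc k))) (ℕP.*-zeroʳ (suc k))) refl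
absorption zero    (suc t) = trans (lem (compositions 2 (suc t)) (absorption zero t)) refl
  where
  lem : ∀ x → 1 ℕ.* x ℕ.+ 0 ≡ t ℕ.* compositions 1 (suc t) → 1 ℕ.* (compositions 1 (suc t) ℕ.+ x) ℕ.+ 0 ≡ suc t ℕ.* compositions 1 (suc (suc t))
  lem x eq rewrite compositions-1 t = trans (ℕP.+-identityʳ _) (trans (ℕP.*-identityˡ _) (cong suc (trans (sym (trans (ℕP.+-identityʳ _) (ℕP.*-identityˡ x))) eq)))
absorption (suc k) (suc t) = go (compositions (suc k) (suc t)) (compositions (suc (suc k)) (suc t)) (compositions (suc (suc (suc k))) (suc t))
    (absorption k t) (absorption (suc k) t)
  where
  go : ∀ a b c → suc k ℕ.* b ℕ.+ k ℕ.* a ≡ t ℕ.* a → suc (suc k) ℕ.* c ℕ.+ suc k ℕ.* b ≡ t ℕ.* b →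
       suc (suc k) ℕ.* (b ℕ.+ c) ℕ.+ suc k ℕ.* (a ℕ.+ b) ≡ suc t ℕ.* (a ℕ.+ b)
  go a b c p q = trans (l₁ k a b c) (trans (cong₂ (λ x y → x ℕ.+ y ℕ.+ (a ℕ.+ b)) p q) (l₂ t a b))
    where
    l₁ : ∀ k a b c → suc (suc k) ℕ.* (b ℕ.+ c) ℕ.+ suc k ℕ.* (a ℕ.+ b) ≡ (suc k ℕ.* b ℕ.+ k ℕ.* a) ℕ.+ (suc (suc k) ℕ.* c ℕ.+ suc k ℕ.* b) ℕ.+ (a ℕ.+ b)
    l₁ = solveℕ
    l₂ : ∀ t a b → t ℕ.* a ℕ.+ t ℕ.* b ℕ.+ (a ℕ.+ b) ≡ suc t ℕ.* (a ℕ.+ b)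
    l₂ = solveℕ

-- The falling factorial t (t - 1) ... (t - k + 1).
falling : ℕ → ℕ → ℕ
falling k t = k ! ℕ.* compositions (suc k) (suc t)

falling-suc : ∀ k t → falling (suc k) t ℕ.+ suc k ℕ.* falling k t ≡ suc t ℕ.* falling k t
falling-suc k t = trans (lem₁ k (k !) (compositions (suc (suc k)) (suc t)) (compositions (suc k) (suc t)))
  (trans (cong (λ x → k ! ℕ.* (x ℕ.+ compositions (suc k) (suc t))) (absorption k t)) (lem₂ t (k !) (compositions (suc k) (suc t))))
  where
  lem₁ : ∀ k f c b → suc k ℕ.* f ℕ.* c ℕ.+ suc k ℕ.* (f ℕ.* b) ≡ f ℕ.* ((suc k ℕ.* c ℕ.+ k ℕ.* b) ℕ.+ b)
  lem₁ = solveℕ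
  lem₂ : ∀ t f b → f ℕ.* (t ℕ.* b ℕ.+ b) ≡ suc t ℕ.* (f ℕ.* b)
  lem₂ = solveℕ

falling-0 : ∀ t → falling 0 t ≡ 1
falling-0 t = trans (ℕP.*-identityˡ _) (compositions-1 t)

falling-upper : ∀ k t → falling k t ≤ suc t ℕ.^ k
falling-upper zero    t = ℕP.≤-reflexive (falling-0 t)
falling-upper (suc k) t = ℕP.≤-trans (ℕP.m≤m+n _ (suc k ℕ.* falling k t))
  (ℕP.≤-trans (ℕP.≤-reflexive (falling-suc k t)) (ℕP.*-monoʳ-≤ (suc t) (falling-upper k t)))

triangle : ℕ → ℕ
triangle zero    = 0
triangle (suc k) = suc k ℕ.+ triangle k

-- With u = t + 1 the falling factorial is (u - 1) ... (u - k), which is at least u^k - (1 + ... +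
-- k) u^(k-1). Multiplying by u avoids the exponent k - 1.
falling-lower : ∀ k t → suc t ℕ.^ k ℕ.* suc t ≤ falling k t ℕ.* suc t ℕ.+ triangle k ℕ.* suc t ℕ.^ k
falling-lower zero    t = ℕP.≤-reflexive (trans (cong (ℕ._* suc t) (sym (falling-0 t))) (sym (ℕP.+-identityʳ _)))
falling-lower (suc k) t = begin
  u ℕ.* u ℕ.^ k ℕ.* u                                        ≡⟨ ℕP.*-assoc u (u ℕ.^ k) u ⟩
  u ℕ.* (u ℕ.^ k ℕ.* u)                                      ≤⟨ ℕP.*-monoʳ-≤ u (falling-lower k t) ⟩
  u ℕ.* (P ℕ.* u ℕ.+ triangle k ℕ.* u ℕ.^ k)                 ≡⟨ l₁ u P (triangle k) (u ℕ.^ k) ⟩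
  (u ℕ.* P) ℕ.* u ℕ.+ triangle k ℕ.* (u ℕ.* u ℕ.^ k)         ≡⟨ cong (λ x → x ℕ.* u ℕ.+ triangle k ℕ.* (u ℕ.* u ℕ.^ k)) (sym (falling-suc k t)) ⟩
  (Q ℕ.+ suc k ℕ.* P) ℕ.* u ℕ.+ triangle k ℕ.* (u ℕ.* u ℕ.^ k)
    ≤⟨ ℕP.+-monoˡ-≤ (triangle k ℕ.* (u ℕ.* u ℕ.^ k)) (ℕP.*-monoˡ-≤ u (ℕP.+-monoʳ-≤ Q (ℕP.*-monoʳ-≤ (suc k) (falling-upper k t)))) ⟩
  (Q ℕ.+ suc k ℕ.* u ℕ.^ k) ℕ.* u ℕ.+ triangle k ℕ.* (u ℕ.* u ℕ.^ k)
                                                             ≡⟨ l₂ u Q (suc k) (triangle k) (u ℕ.^ k) ⟩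
  Q ℕ.* u ℕ.+ (suc k ℕ.+ triangle k) ℕ.* (u ℕ.* u ℕ.^ k)     ∎
  where
  open ℕP.≤-Reasoning
  u = suc t
  P = falling k t
  Q = falling (suc k) t
  l₁ : ∀ u p a x → u ℕ.* (p ℕ.* u ℕ.+ a ℕ.* x) ≡ (u ℕ.* p) ℕ.* u ℕ.+ a ℕ.* (u ℕ.* x)
  l₁ = solveℕ
  l₂ : ∀ u q k a x → (q ℕ.+ k ℕ.* x) ℕ.* u ℕ.+ a ℕ.* (u ℕ.* x) ≡ q ℕ.* u ℕ.+ (k ℕ.+ a) ℕ.* (u ℕ.* x)
  l₂ = solveℕ

-- Supports with at most `d` arcs stay one order below the leading term.
compositions-small : ∀ k d t → k ≤ d → compositions k (suc t) ℕ.* suc t ≤ suc t ℕ.^ d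
compositions-small zero    d t _  = z≤n
compositions-small (suc k) d t le = ℕP.≤-trans (ℕP.*-monoˡ-≤ (suc t) (ℕP.≤-trans (ℕP.m≤n*m _ (k !) {{k !≢0}}) (falling-upper k t)))
  (ℕP.≤-trans (ℕP.≤-reflexive (ℕP.*-comm (suc t ℕ.^ k) (suc t))) (ℕP.^-monoʳ-≤ (suc t) le))

-- `triangle d` covers supports with d + 1 arcs, `d !` covers the smaller ones; the sum serves for
-- both.
errorConstant : ℕ → ℕ
errorConstant d = triangle d ℕ.+ d !

module _ (d t : ℕ) where
  private
    u = suc t
    K = errorConstant d

  -- The leading coefficient of a support with `k` arcs: 1 for the maximal size d + 1, that of
  -- spanning trees, and 0 otherwise.
  δ : ℕ → ℕ
  δ k = if does (suc k ℕP.≟ suc (suc d)) then 1 else 0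

  compositions-error : ∀ k → k ≤ suc d →
    d ! ℕ.* compositions k u ℕ.* u ≤ δ k ℕ.* u ℕ.^ d ℕ.* u ℕ.+ K ℕ.* u ℕ.^ d ×
    δ k ℕ.* u ℕ.^ d ℕ.* u ≤ d ! ℕ.* compositions k u ℕ.* u ℕ.+ K ℕ.* u ℕ.^ d
  compositions-error k le with k ℕP.≟ suc d
  ... | yes refl rewrite dec-true (suc d ℕP.≟ suc d) refl =
    ℕP.≤-trans (ℕP.*-monoˡ-≤ u (ℕP.≤-trans (falling-upper d t) (ℕP.≤-reflexive (sym (ℕP.*-identityˡ (u ℕ.^ d)))))) (ℕP.m≤m+n _ _) ,
    ℕP.≤-trans (ℕP.≤-reflexive (cong (ℕ._* u) (ℕP.*-identityˡ (u ℕ.^ d))))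
      (ℕP.≤-trans (falling-lower d t) (ℕP.+-monoʳ-≤ (falling d t ℕ.* u) (ℕP.*-monoˡ-≤ (u ℕ.^ d) (ℕP.m≤m+n (triangle d) (d !)))))
  ... | no ne rewrite dec-false (k ℕP.≟ suc d) ne =
    ℕP.≤-trans (ℕP.≤-reflexive (ℕP.*-assoc (d !) (compositions k u) u))
      (ℕP.≤-trans (ℕP.*-monoʳ-≤ (d !) (compositions-small k d t (ℕP.≤-pred (ℕP.≤∧≢⇒< le ne))))
        (ℕP.*-monoˡ-≤ (u ℕ.^ d) (ℕP.m≤n+m (d !) (triangle d)))) ,
    z≤n

  count-error : ∀ (Fs : List (Subset k)) → All (λ F → card F ≤ suc d) Fs →
    let L = length (concatMap (λ F → weightings F u) Fs)
        v = length (filter (hasSize? (suc (suc d))) Fs) in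
    d ! ℕ.* L ℕ.* u ≤ v ℕ.* u ℕ.^ d ℕ.* u ℕ.+ length Fs ℕ.* K ℕ.* u ℕ.^ d ×
    v ℕ.* u ℕ.^ d ℕ.* u ≤ d ! ℕ.* L ℕ.* u ℕ.+ length Fs ℕ.* K ℕ.* u ℕ.^ d
  count-error []       []         = ℕP.≤-trans (ℕP.≤-reflexive (cong (ℕ._* u) (ℕP.*-zeroʳ (d !)))) z≤n , z≤n
  count-error (F ∷ Fs) (le ∷ les) =
    let p , q = compositions-error (card F) le
        p′ , q′ = count-error Fs les
        c = compositions (card F) u
        L = length (concatMap (λ F → weightings F u) Fs)
        v = length (filter (hasSize? (suc (suc d))) Fs) in
    subst₂ _≤_ (sym (trans (cong (λ x → d ! ℕ.* x ℕ.* u) L≡) (lhs (d !) c L u)))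
      (trans (rhs (δ (card F)) v (length Fs) (u ℕ.^ d) u K) (cong (λ x → x ℕ.* u ℕ.^ d ℕ.* u ℕ.+ suc (length Fs) ℕ.* K ℕ.* u ℕ.^ d) (sym v≡)))
      (ℕP.+-mono-≤ p p′) ,
    subst₂ _≤_ (sym (trans (cong (λ x → x ℕ.* u ℕ.^ d ℕ.* u) v≡) (lhs′ (δ (card F)) v (u ℕ.^ d) u)))
      (trans (rhs′ (d !) c L (length Fs) (u ℕ.^ d) u K) (cong (λ x → d ! ℕ.* x ℕ.* u ℕ.+ suc (length Fs) ℕ.* K ℕ.* u ℕ.^ d) (sym L≡)))
      (ℕP.+-mono-≤ q q′)
    where
    L≡ : length (concatMap (λ F → weightings F u) (F ∷ Fs)) ≡ compositions (card F) u ℕ.+ length (concatMap (λ F → weightings F u) Fs)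
    L≡ = trans (ListP.length-++ (weightings F u)) (cong (ℕ._+ _) (length-weightings F u))
    v≡ : length (filter (hasSize? (suc (suc d))) (F ∷ Fs)) ≡ δ (card F) ℕ.+ length (filter (hasSize? (suc (suc d))) Fs)
    v≡ with does (hasSize? (suc (suc d)) F)
    ... | true  = refl
    ... | false = refl
    lhs : ∀ f c L u → f ℕ.* (c ℕ.+ L) ℕ.* u ≡ f ℕ.* c ℕ.* u ℕ.+ f ℕ.* L ℕ.* u
    lhs = solveℕ
    rhs : ∀ e v l x u K → (e ℕ.* x ℕ.* u ℕ.+ K ℕ.* x) ℕ.+ (v ℕ.* x ℕ.* u ℕ.+ l ℕ.* K ℕ.* x) ≡ (e ℕ.+ v) ℕ.* x ℕ.* u ℕ.+ suc l ℕ.* K ℕ.* x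
    rhs = solveℕ
    lhs′ : ∀ e v x u → (e ℕ.+ v) ℕ.* x ℕ.* u ≡ e ℕ.* x ℕ.* u ℕ.+ v ℕ.* x ℕ.* u
    lhs′ = solveℕ
    rhs′ : ∀ f c L l x u K → (f ℕ.* c ℕ.* u ℕ.+ K ℕ.* x) ℕ.+ (f ℕ.* L ℕ.* u ℕ.+ l ℕ.* K ℕ.* x) ≡ f ℕ.* (c ℕ.+ L) ℕ.* u ℕ.+ suc l ℕ.* K ℕ.* x
    rhs′ = solveℕ

-- The two estimates say |a - v| u ≤ C x; since u is at least C (e + 1), the distance is at most x /
-- (e + 1).
distance-bound : ∀ a v u x C e → 0 ℕ.< u → C ℕ.* suc e ≤ u →
                 a ℕ.* u ≤ v ℕ.* u ℕ.+ C ℕ.* x → v ℕ.* u ≤ a ℕ.* u ℕ.+ C ℕ.* x →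
                 ℤ.∣ + a ℤ.- + v ∣ ℕ.* suc e ≤ x
distance-bound a v u@(suc _) x C e _ large p q = ℕP.*-cancelʳ-≤ _ x u (begin
  ℤ.∣ + a ℤ.- + v ∣ ℕ.* suc e ℕ.* u    ≡⟨ swap ℤ.∣ + a ℤ.- + v ∣ (suc e) u ⟩
  ℤ.∣ + a ℤ.- + v ∣ ℕ.* u ℕ.* suc e    ≤⟨ ℕP.*-monoˡ-≤ (suc e) dist ⟩
  C ℕ.* x ℕ.* suc e                    ≡⟨ swap′ C x (suc e) ⟩
  x ℕ.* (C ℕ.* suc e)                  ≤⟨ ℕP.*-monoʳ-≤ x large ⟩
  x ℕ.* u                              ∎)
  where
  open ℕP.≤-Reasoning
  swap : ∀ a e u → a ℕ.* e ℕ.* u ≡ a ℕ.* u ℕ.* e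
  swap = solveℕ
  swap′ : ∀ C x e → C ℕ.* x ℕ.* e ≡ x ℕ.* (C ℕ.* e)
  swap′ = solveℕ
  excess : ∀ {b c} → b ≤ c → c ℕ.* u ≤ b ℕ.* u ℕ.+ C ℕ.* x → (c ℕ.∸ b) ℕ.* u ≤ C ℕ.* x
  excess {b} {c} le r = ℕP.≤-trans (ℕP.≤-reflexive (ℕP.*-distribʳ-∸ u c b)) (ℕP.m≤n+o⇒m∸n≤o (c ℕ.* u) (b ℕ.* u) r)
  dist : ℤ.∣ + a ℤ.- + v ∣ ℕ.* u ≤ C ℕ.* x
  dist rewrite ℤP.m-n≡m⊖n a v with ℕP.≤-total a v
  ... | inj₁ a≤v rewrite ℤP.∣⊖∣-≤ a≤v = excess a≤v q
  ... | inj₂ v≤a rewrite ℤP.∣m⊖n∣≡∣n⊖m∣ a v | ℤP.∣⊖∣-≤ v≤a = excess v≤a p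

-- Lattice points of the dilates

vert : Arc n → Pt (n ℕ.+ n)
vert (i , j) = unitVec i Vec.++ unitVec j

add-unit : ∀ z (i : Fin n) p → zipWith _+_ (scale z (unitVec i)) p ≡ updateAt p i (λ x → z + x)
add-unit z i p = vec-ext λ k → trans (VecP.lookup-zipWith _+_ k (scale z (unitVec i)) p)
  (trans (cong (_+ lookup p k) (trans (VecP.lookup-map k (z *_) (unitVec i)) (cong (z *_) (VecP.lookup∘tabulate _ k)))) (go k))
  where
  go : ∀ k → z * (if ⌊ k Fin.≟ i ⌋ then + 1 else + 0) + lookup p k ≡ lookup (updateAt p i (λ x → z + x)) k
  go k with k Fin.≟ i
  ... | yes refl = trans (cong (_+ lookup p k) (ℤP.*-identityʳ z)) (sym (VecP.lookup∘updateAt k p))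
  ... | no ne    = trans (cong (_+ lookup p k) (ℤP.*-zeroʳ z)) (trans (ℤP.+-identityˡ _) (sym (VecP.lookup∘updateAt′ k i ne p)))

zeros-++ : ∀ m n → zeros (m ℕ.+ n) ≡ zeros m Vec.++ zeros n
zeros-++ zero    n = refl
zeros-++ (suc m) n = cong (+ 0 ∷_) (zeros-++ m n)

margins : (es : List (Arc n)) → Vec ℤ (length es) → Pt (n ℕ.+ n)
margins es z = marginℤ proj₁ es z Vec.++ marginℤ proj₂ es z

len : ∀ (es : List (Arc n)) → length (map vert es) ≡ length es
len es = ListP.length-map vert es

zcomb-margins : ∀ (es : List (Arc n)) c → zcomb (map vert es) c ≡ margins es (cast (len es) c)
zcomb-margins {n} []       []      = zeros-++ n n
zcomb-margins (e ∷ es) (z ∷ c) =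
  trans (cong (zipWith _+_ (scale z (vert e))) (zcomb-margins es c))
    (trans (cong (λ v → zipWith _+_ v (margins es c′)) (VecP.map-++ (z *_) (unitVec (proj₁ e)) (unitVec (proj₂ e))))
      (trans (VecP.zipWith-++ _+_ (scale z (unitVec (proj₁ e))) (scale z (unitVec (proj₂ e))) (marginℤ proj₁ es c′) (marginℤ proj₂ es c′))
        (cong₂ Vec._++_ (add-unit z (proj₁ e) (marginℤ proj₁ es c′)) (add-unit z (proj₂ e) (marginℤ proj₂ es c′)))))
  where c′ = cast (len es) c

toℤ-injective : ∀ {x y : Vec ℕ k} → toℤ x ≡ toℤ y → x ≡ y
toℤ-injective {x = []}    {[]}    _  = refl
toℤ-injective {x = a ∷ x} {b ∷ y} eq = cong₂ _∷_ (ℤP.+-injective (VecP.∷-injectiveˡ eq)) (toℤ-injective (VecP.∷-injectiveʳ eq))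

point : (es : List (Arc n)) → Vec ℕ (length es) → Pt (n ℕ.+ n)
point es W = toℤ (margin proj₁ es W) Vec.++ toℤ (margin proj₂ es W)

margins-toℤ : ∀ (es : List (Arc n)) W → margins es (toℤ W) ≡ point es W
margins-toℤ es W = cong₂ Vec._++_ (marginℤ-toℤ proj₁ es W) (marginℤ-toℤ proj₂ es W)

point-injective : ∀ (es : List (Arc n)) {V W} → Good es V → Good es W → point es V ≡ point es W → V ≡ W
point-injective es {V} {W} gV gW eq with VecP.++-injective (toℤ (margin proj₁ es V)) (toℤ (margin proj₁ es W)) eq
... | p , q = good-unique es gV gW (toℤ-injective p , toℤ-injective q) (refl , refl)

sumℕ-cast : ∀ .(eq : k ≡ m) (x : Vec ℕ k) → sumℕ (cast eq x) ≡ sumℕ x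
sumℕ-cast {m = zero}  eq []      = refl
sumℕ-cast {m = suc m} eq (a ∷ x) = cong (a ℕ.+_) (sumℕ-cast (ℕP.suc-injective eq) x)

cast-cast : ∀ .(eq : k ≡ m) .(eq′ : m ≡ k) (x : Vec A k) → cast eq′ (cast eq x) ≡ x
cast-cast eq eq′ x = trans (VecP.cast-trans eq eq′ x) (VecP.cast-is-id _ x)

scale-1 : ∀ (p : Pt k) → scale (+ 1) p ≡ p
scale-1 []      = refl
scale-1 (x ∷ p) = cong₂ _∷_ (ℤP.*-identityˡ x) (scale-1 p)

point-inDilate : ∀ (es : List (Arc n)) W → InDilate (map vert es) (sumℕ W) (point es W)
point-inDilate es W = 1 , cast (sym (len es)) W , ℕP.≤-refl ,
  trans (sumℕ-cast (sym (len es)) W) (sym (ℕP.*-identityˡ (sumℕ W))) ,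
  trans (zcomb-margins es _) (trans (cong (margins es)
      (trans (sym (VecP.map-cast (+_) (len es) _)) (cong toℤ (cast-cast (sym (len es)) (len es) W))))
    (trans (margins-toℤ es W) (sym (scale-1 (point es W)))))

divide : ∀ m (x : Vec ℕ k) p → toℤ x ≡ scale (+ suc m) p → Σ (Vec ℕ k) λ y → p ≡ toℤ y × x ≡ Vec.map (suc m ℕ.*_) y
divide m []      []             eq = [] , refl , refl
divide m (a ∷ x) (+ b ∷ p)      eq =
  let y , py , xy = divide m x p (VecP.∷-injectiveʳ eq) in
  b ∷ y , cong (+ b ∷_) py , cong₂ _∷_ (ℤP.+-injective (trans (VecP.∷-injectiveˡ eq) (sym (ℤP.pos-* (suc m) b)))) xy
divide m (a ∷ x) (-[1+ b ] ∷ p) eq with () ← VecP.∷-injectiveˡ eq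

sumOver-scale : ∀ m S (y : Vec ℕ k) → sumOver S (Vec.map (m ℕ.*_) y) ≡ m ℕ.* sumOver S y
sumOver-scale m []          []      = sym (ℕP.*-zeroʳ m)
sumOver-scale m (true ∷ S)  (a ∷ y) = trans (cong (m ℕ.* a ℕ.+_) (sumOver-scale m S y)) (sym (ℕP.*-distribˡ-+ m a (sumOver S y)))
sumOver-scale m (false ∷ S) (a ∷ y) = sumOver-scale m S y

sumℕ-scale : ∀ m (y : Vec ℕ k) → sumℕ (Vec.map (m ℕ.*_) y) ≡ m ℕ.* sumℕ y
sumℕ-scale m y = trans (sym (sumOver-⊤ (Vec.map (m ℕ.*_) y))) (trans (sumOver-scale m ⊤ y) (cong (m ℕ.*_) (sumOver-⊤ y)))

transportable-unscale : ∀ m (es : List (Arc n)) {x y} → Transportable es (Vec.map (suc m ℕ.*_) x) (Vec.map (suc m ℕ.*_) y) → Transportable es x y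
transportable-unscale m es {x} {y} T = record
  { balanced = ℕP.*-cancelˡ-≡ _ _ (suc m) (trans (sym (sumℕ-scale (suc m) x)) (trans balanced (sumℕ-scale (suc m) y)))
  ; cut = λ S B c → ℕP.*-cancelˡ-≤ (suc m) (subst₂ _≤_ (sumOver-scale (suc m) S x) (sumOver-scale (suc m) B y) (cut S B c))
  }
  where open Transportable T

-- Gale's condition is homogeneous: the multiple of `p` that is an integral combination satisfies
-- it, hence so does `p`, and `transport` then writes `p` itself as a sum of `t` vertices.
inDilate-good : ∀ (es : List (Arc n)) t p → InDilate (map vert es) t p →
                Σ (Vec ℕ (length es)) λ W → Good es W × sumℕ W ≡ t × p ≡ point es W
inDilate-good {n} es t p (suc m , μ , _ , total , eq) with Vec.splitAt n p
... | p₁ , p₂ , refl = W , proj₁ (proj₂ flow) , sumW , cong₂ Vec._++_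
        (trans (proj₁ (proj₂ d₁)) (cong toℤ (sym (proj₁ hm)))) (trans (proj₁ (proj₂ d₂)) (cong toℤ (sym (proj₂ hm))))
  where
  V : Vec ℕ (length es)
  V = cast (len es) μ
  split : point es V ≡ scale (+ suc m) p₁ Vec.++ scale (+ suc m) p₂
  split = trans (sym (margins-toℤ es V)) (trans (cong (margins es) (VecP.map-cast (+_) (len es) μ))
    (trans (sym (zcomb-margins es (toℤ μ))) (trans eq (VecP.map-++ (+ suc m *_) p₁ p₂))))
  halves = VecP.++-injective (toℤ (margin proj₁ es V)) (scale (+ suc m) p₁) split
  d₁ = divide m (margin proj₁ es V) p₁ (proj₁ halves)
  d₂ = divide m (margin proj₂ es V) p₂ (proj₂ halves)
  flow = transport es (transportable-unscale m es (hasMargins⇒transportable es {V} (proj₂ (proj₂ d₁) , proj₂ (proj₂ d₂))))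
  W = proj₁ flow
  hm = proj₂ (proj₂ flow)
  sumW : sumℕ W ≡ t
  sumW = ℕP.*-cancelˡ-≡ _ _ (suc m) (trans (cong (suc m ℕ.*_) (trans (sym (sumℕ-margin proj₁ es W)) (cong sumℕ (proj₁ hm))))
    (trans (sym (sumℕ-scale (suc m) (proj₁ d₁))) (trans (cong sumℕ (sym (proj₂ (proj₂ d₁))))
      (trans (sumℕ-margin proj₁ es V) (trans (sumℕ-cast (len es) μ) total)))))

latticeCount : ∀ (es : List (Arc n)) t → LatticeCount (map vert es) t (length (goodWeightings es t))
latticeCount es t = map (point es) (goodWeightings es t) ,
  unique-map (λ p q → point-injective es (proj₁ (goodWeightings-sound es t p)) (proj₁ (goodWeightings-sound es t q))) (unique-goodWeightings es t) ,
  ListP.length-map (point es) (goodWeightings es t) ,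
  λ p → mk⇔ (to p) (from p)
  where
  to : ∀ p → p ∈ map (point es) (goodWeightings es t) → InDilate (map vert es) t p
  to p m = let W , W∈ , eq = ∈-map⁻ (point es) m in
    subst₂ (InDilate (map vert es)) (proj₂ (goodWeightings-sound es t W∈)) (sym eq) (point-inDilate es W)
  from : ∀ p → InDilate (map vert es) t p → p ∈ map (point es) (goodWeightings es t)
  from p d = let W , good , total , eq = inDilate-good es t p d in
    subst (_∈ map (point es) (goodWeightings es t)) (sym eq)
      (∈-map⁺ (point es) (subst (λ s → W ∈ goodWeightings es s) total (∈-goodWeightings es good)))

-- Dimension

sumℤ-margin : ∀ (es : List (Arc n)) c → dot ⊤ (marginℤ proj₁ es c) ≡ sumℤ c
sumℤ-margin {n} [] [] = dot-zeros {n} ⊤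
sumℤ-margin (e ∷ es) (z ∷ c) = trans (dot-updateAt ⊤ (marginℤ proj₁ es c) (proj₁ e) z)
  (cong₂ _+_ (trans (cong (λ b → z * ι b) (lookup-⊤ (proj₁ e))) (ℤP.*-identityʳ z)) (sumℤ-margin es c))

sumℤ-cast : ∀ .(eq : k ≡ m) (x : Vec ℤ k) → sumℤ (cast eq x) ≡ sumℤ x
sumℤ-cast {m = zero}  eq []      = refl
sumℤ-cast {m = suc m} eq (a ∷ x) = cong (λ x → a + x) (sumℤ-cast (ℕP.suc-injective eq) x)

cast-zeros : ∀ .(eq : k ≡ m) → cast eq (zeros k) ≡ zeros m
cast-zeros {zero}  {zero}  eq = refl
cast-zeros {suc k} {suc m} eq = cong (+ 0 ∷_) (cast-zeros (ℕP.suc-injective eq))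

-- The row sums of a combination total its coefficient sum, so vanishing margins already make that
-- sum 0. Thus affine and linear independence agree for these vertices.
affInd⇒independent : ∀ (es : List (Arc n)) → AffInd (map vert es) → Independent es
affInd⇒independent {n} es aff c circ = trans (sym (cast-cast (sym (len es)) (len es) c))
  (trans (cong (cast (len es)) (aff c′ sum0 comb0)) (cast-zeros (len es)))
  where
  c′ = cast (sym (len es)) c
  ms = circ⇒margins es circ
  sum0 : sumℤ c′ ≡ + 0
  sum0 = trans (sumℤ-cast (sym (len es)) c) (trans (sym (sumℤ-margin es c)) (trans (cong (dot ⊤) (proj₁ ms)) (dot-zeros {n} ⊤)))
  comb0 : zcomb (map vert es) c′ ≡ zeros (n ℕ.+ n)
  comb0 = trans (zcomb-margins es c′) (trans (cong (margins es) (cast-cast (sym (len es)) (len es) c))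
    (trans (cong₂ Vec._++_ (proj₁ ms) (proj₂ ms)) (sym (zeros-++ n n))))

independent⇒affInd : ∀ (es : List (Arc n)) → Independent es → AffInd (map vert es)
independent⇒affInd {n} es ind c _ comb0 = trans (sym (cast-cast (len es) (sym (len es)) c))
  (trans (cong (cast (sym (len es))) (ind c′ (margins⇒circ es (proj₁ ms) (proj₂ ms)))) (cast-zeros (sym (len es))))
  where
  c′ = cast (len es) c
  ms = VecP.++-injective (marginℤ proj₁ es c′) (zeros n) (trans (sym (zcomb-margins es c)) (trans comb0 (zeros-++ n n)))

preimages : ∀ (f : A → B) {xs : List A} ps → (∀ {y} → y ∈ ps → y ∈ map f xs) → Σ (List A) λ ys → ps ≡ map f ys
preimages f []       sub = [] , refl
preimages f (p ∷ ps) sub =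
  let x , _ , eq = ∈-map⁻ f (sub (here refl))
      ys , eqs = preimages f ps (λ m → sub (there m))
  in x ∷ ys , cong₂ _∷_ eq eqs

-- A spanning tree gives 2m + 1 affinely independent vertices, and the forest bound forbids more.
isDim : ∀ (es : List (Arc (suc m))) → (Σ (List (Arc (suc m))) λ fs → (∀ {e} → e ∈ fs → e ∈ es) × Independent fs × suc (length fs) ≡ suc m ℕ.+ suc m) →
        IsDim (map vert es) (m ℕ.+ m)
isDim {m} es (fs , sub , ind , size) =
  (map vert fs , (λ p → let e , e∈ , eq = ∈-map⁻ vert p in subst (_∈ map vert es) (sym eq) (∈-map⁺ vert (sub e∈))) ,
    trans (ListP.length-map vert fs) (ℕP.suc-injective (trans size twice)) , independent⇒affInd fs ind) ,
  λ ps sub′ aff → let gs , eq = preimages vert ps sub′ in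
    subst (λ qs → length qs ≤ suc (m ℕ.+ m)) (sym eq)
      (subst (ℕ._≤ suc (m ℕ.+ m)) (sym (ListP.length-map vert gs))
        (ℕP.≤-pred (subst (length gs ℕ.<_) twice (independent-size gs (affInd⇒independent gs (subst AffInd eq aff))))))
  where
  twice : suc m ℕ.+ suc m ≡ suc (suc (m ℕ.+ m))
  twice = cong suc (ℕP.+-suc m m)

nvol : ∀ (es : List (Arc (suc m))) → IsDim (map vert es) (m ℕ.+ m) → NVol (map vert es) (length (dragons es))
nvol {m} es dim = d , dim , (λ t → length (goodWeightings es t)) , latticeCount es , limit
  where
  d = m ℕ.+ m
  twice : suc m ℕ.+ suc m ≡ suc (suc d)
  twice = cong suc (ℕP.+-suc m m)
  Fs = goodSets es
  C = length Fs ℕ.* errorConstant d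
  small : All (λ F → card F ≤ suc d) Fs
  small = All.tabulate λ {F} F∈ → ℕP.≤-pred (subst (card F ℕ.<_) twice (goodSet-size es F (goodSets-good es F∈)))
  v≡ : length (filter (hasSize? (suc (suc d))) Fs) ≡ length (dragons es)
  v≡ = trans (cong (λ s → length (filter (hasSize? s) Fs)) (sym twice)) (sym (ListP.length-map (treeDragon es) (trees es)))
  limit : ∀ e → Σ ℕ λ T → ∀ t → T ≤ t →
    ℤ.∣ + (d ! ℕ.* length (goodWeightings es t)) ℤ.- + (length (dragons es) ℕ.* t ℕ.^ d) ∣ ℕ.* suc e ≤ t ℕ.^ d
  -- The outer `suc` makes the dilation factor positive, as `count-error` requires.
  limit e = suc (C ℕ.* suc e) , λ { (suc t) (s≤s le) → subst
    (λ v → ℤ.∣ + (d ! ℕ.* length (goodWeightings es (suc t))) ℤ.- + (v ℕ.* suc t ℕ.^ d) ∣ ℕ.* suc e ≤ suc t ℕ.^ d) v≡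
    (let p , q = count-error d t Fs small in
     distance-bound (d ! ℕ.* length (goodWeightings es (suc t))) (length (filter (hasSize? (suc (suc d))) Fs) ℕ.* suc t ℕ.^ d)
       (suc t) (suc t ℕ.^ d) C e (s≤s z≤n) (ℕP.m≤n⇒m≤1+n le) p q) }

-- The bipartite graph D(G)

joined : SimpleGraph n → Fin n → Fin n → Bool
joined G i j = ⌊ i Fin.≟ j ⌋ ∨ adj G i j

arcsAt : SimpleGraph n → Fin n → Fin n → List (Arc n)
arcsAt G i j = if joined G i j then (i , j) ∷ [] else []

arcs : SimpleGraph n → List (Arc n)
arcs {n} G = concatMap (λ i → concatMap (arcsAt G i) (allFin n)) (allFin n)

vertices≡ : ∀ (G : SimpleGraph n) → PQVerts G ≡ map vert (arcs G)
vertices≡ {n} G = sym (trans (ListP.map-concatMap vert (λ i → concatMap (arcsAt G i) (allFin n)) (allFin n))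
  (ListP.concatMap-cong (λ i → trans (ListP.map-concatMap vert (arcsAt G i) (allFin n)) (ListP.concatMap-cong (single i) (allFin n))) (allFin n)))
  where
  single : ∀ i j → map vert (arcsAt G i j) ≡ (if joined G i j then List.[ unitVec i Vec.++ unitVec j ] else [])
  single i j with joined G i j
  ... | true  = refl
  ... | false = refl

∈-arcs : ∀ (G : SimpleGraph n) i j → joined G i j ≡ true → (i , j) ∈ arcs G
∈-arcs {n} G i j p = ∈-concatMap⁺ (λ i → concatMap (arcsAt G i) (allFin n)) (lose (∈-allFin i)
  (∈-concatMap⁺ (arcsAt G i) (lose (∈-allFin j) at)))
  where
  at : (i , j) ∈ arcsAt G i j
  at rewrite p = here refl

arcs-joined : ∀ (G : SimpleGraph n) {e} → e ∈ arcs G → joined G (proj₁ e) (proj₂ e) ≡ true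
arcs-joined {n} G {e} m =
  let i , _ , mi = find (∈-concatMap⁻ (λ i → concatMap (arcsAt G i) (allFin n)) {allFin n} m)
      j , _ , mj = find (∈-concatMap⁻ (arcsAt G i) {allFin n} mi)
  in at i j mj
  where
  at : ∀ i j → e ∈ arcsAt G i j → joined G (proj₁ e) (proj₂ e) ≡ true
  at i j m with joined G i j in eq
  at i j (here refl) | true = eq

anyV⁺ : ∀ (f : Fin k → Bool) i → f i ≡ true → anyV (tabulate f) ≡ true
anyV⁺ f zero    p rewrite p = refl
anyV⁺ f (suc i) p rewrite anyV⁺ (λ i → f (suc i)) i p = BoolP.∨-zeroʳ (f zero)

anyV⁻ : ∀ (f : Fin k → Bool) → anyV (tabulate f) ≡ true → ∃ λ i → f i ≡ true
anyV⁻ {suc k} f p with f zero in eq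
... | true  = zero , eq
... | false = let i , q = anyV⁻ (λ i → f (suc i)) p in suc i , q

closed-nbhd : ∀ (G : SimpleGraph n) S → Closed (arcs G) S (closedNbhd G S)
closed-nbhd G S = All.tabulate λ {e} m → respects (le e (arcs-joined G m))
  where
  le : ∀ e → joined G (proj₁ e) (proj₂ e) ≡ true → lookup S (proj₁ e) ≤ᴮ lookup (closedNbhd G S) (proj₂ e)
  le (i , j) p rewrite VecP.lookup∘tabulate (λ j → anyV (tabulate λ i → lookup S i ∧ joined G i j)) j with lookup S i in eq
  ... | false = BoolP.≤-minimum _
  ... | true rewrite anyV⁺ (λ i → lookup S i ∧ joined G i j) i (cong₂ _∧_ eq p) = b≤b

nbhd-least : ∀ (G : SimpleGraph n) S B → Closed (arcs G) S B → card (closedNbhd G S) ≤ card B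
nbhd-least G S B c = p⊆q⇒∣p∣≤∣q∣ {p = closedNbhd G S} {B} λ {j} m → VecP.lookup⇒[]= j B (sub j (VecP.[]=⇒lookup m))
  where
  sub : ∀ j → lookup (closedNbhd G S) j ≡ true → lookup B j ≡ true
  sub j p with anyV⁻ (λ i → lookup S i ∧ joined G i j) (trans (sym (VecP.lookup∘tabulate _ j)) p)
  ... | i , q with lookup S i in eq
  ...   | true = BoolP.≤-antisym (BoolP.≤-maximum _) (subst (_≤ᴮ lookup B j) eq (Respects.ordered (All.lookup c (∈-arcs G i j q))))

-- The closed neighbourhood of `S` is the least `B` closed with `S`, so its inequality implies all
-- the others.
dragon⇔draconian : ∀ (G : SimpleGraph (suc m)) a → Dragon (arcs G) a ⇔ Draconian G a
dragon⇔draconian G a = mk⇔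
  (λ D → ℕP.suc-injective (Dragon.total D) , λ S (i , i∈S) → Dragon.marriage D S (closedNbhd G S) i (VecP.[]=⇒lookup i∈S) (closed-nbhd G S))
  (λ (total , marriage) → record
    { total = cong suc total
    ; marriage = λ S B i i∈S c → ℕP.<-≤-trans (marriage S (i , VecP.lookup⇒[]= i S i∈S)) (nbhd-least G S B c) })

-- A spanning tree of D(G)

-- A spanning tree of the rows and columns indexed by `U`: a forest with 2|U| - 1 arcs. `root` is
-- where a path towards a vertex outside `U` starts.
record Grown (es : List (Arc n)) (U : Subset n) : Set where
  field
    fs     : List (Arc n)
    sub    : ∀ {e} → e ∈ fs → e ∈ es
    inside : All (Within U U) fs
    ind    : Independent fs
    size   : suc (length fs) ≡ card U ℕ.+ card U
    root   : Fin n
    root∈  : lookup U root ≡ true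

marginℤ-cons : ∀ (π : Arc n → Fin n) e es z c → lookup (marginℤ π (e ∷ es) (z ∷ c)) (π e) ≡ z + lookup (marginℤ π es c) (π e)
marginℤ-cons π e es z c = VecP.lookup∘updateAt (π e) (marginℤ π es c)

marginℤ-skip : ∀ (π : Arc n → Fin n) e es z c i → i ≢ π e → lookup (marginℤ π (e ∷ es) (z ∷ c)) i ≡ lookup (marginℤ π es c) i
marginℤ-skip π e es z c i ne = VecP.lookup∘updateAt′ i (π e) ne (marginℤ π es c)

circ-tail : ∀ (e : Arc n) es c → Circ (e ∷ es) (+ 0 ∷ c) → Circ es c
circ-tail e es c circ S B =
  trans (sym (trans (cong (_+ val es c S B) (ℤP.*-zeroˡ (gain e S B))) (ℤP.+-identityˡ (val es c S B)))) (circ S B)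

-- A new vertex v attached to u contributes the arcs (v , v) and (u , v): the first is the only arc in row v,
-- and then the second is the only arc with nonzero weight in column v.
attach : ∀ {fs : List (Arc n)} {u v} → u ≢ v → All (λ e → proj₁ e ≢ v) fs → All (λ e → proj₂ e ≢ v) fs →
         Independent fs → Independent ((v , v) ∷ (u , v) ∷ fs)
attach {fs = fs} {u} {v} u≢v rows cols ind (a ∷ b ∷ c) circ = go a≡0 b≡0 circ
  where
  ms = circ⇒margins ((v , v) ∷ (u , v) ∷ fs) {a ∷ b ∷ c} circ
  a≡0 : a ≡ + 0
  a≡0 = trans (sym (ℤP.+-identityʳ a)) (trans (cong (λ x → a + x) (sym (trans (marginℤ-skip proj₁ (u , v) fs b c v (λ eq → u≢v (sym eq))) (marginℤ-outside proj₁ fs c v rows))))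
    (trans (sym (marginℤ-cons proj₁ (v , v) ((u , v) ∷ fs) a (b ∷ c))) (trans (cong (λ p → lookup p v) (proj₁ ms)) (VecP.lookup-replicate v (+ 0)))))
  a+b≡0 : a + (b + + 0) ≡ + 0
  a+b≡0 = trans (cong (λ x → a + (b + x)) (sym (marginℤ-outside proj₂ fs c v cols)))
    (trans (cong (λ x → a + x) (sym (marginℤ-cons proj₂ (u , v) fs b c)))
    (trans (sym (marginℤ-cons proj₂ (v , v) ((u , v) ∷ fs) a (b ∷ c))) (trans (cong (λ p → lookup p v) (proj₂ ms)) (VecP.lookup-replicate v (+ 0)))))
  b≡0 : b ≡ + 0
  b≡0 = trans (sym (trans (ℤP.+-identityˡ _) (ℤP.+-identityʳ b))) (trans (cong (λ x → x + (b + + 0)) (sym a≡0)) a+b≡0)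
  go : ∀ {a b} → a ≡ + 0 → b ≡ + 0 → Circ ((v , v) ∷ (u , v) ∷ fs) (a ∷ b ∷ c) → a ∷ b ∷ c ≡ zeros _
  go refl refl circ = cong (λ c → + 0 ∷ + 0 ∷ c) (ind c (circ-tail (u , v) fs c (circ-tail (v , v) ((u , v) ∷ fs) (+ 0 ∷ c) circ)))

insert : Fin n → Subset n → Subset n
insert v U = updateAt U v (λ _ → true)

card-insert : ∀ v (U : Subset n) → lookup U v ≡ false → card (insert v U) ≡ suc (card U)
card-insert zero    (false ∷ U) p = refl
card-insert (suc v) (true ∷ U)  p = cong suc (card-insert v U p)
card-insert (suc v) (false ∷ U) p = card-insert v U p

insert-old : ∀ v (U : Subset n) i → lookup U i ≡ true → lookup (insert v U) i ≡ true
insert-old v U i p with i Fin.≟ v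
... | yes refl = VecP.lookup∘updateAt v U
... | no ne    = trans (VecP.lookup∘updateAt′ i v ne U) p

grow : ∀ {es : List (Arc n)} {U} u v → lookup U u ≡ true → lookup U v ≡ false → (v , v) ∈ es → (u , v) ∈ es →
       Grown es U → Grown es (insert v U)
grow {es = es} {U} u v u∈ v∉ vv uv g = record
  { fs = (v , v) ∷ (u , v) ∷ fs
  ; sub = λ { (here refl) → vv ; (there (here refl)) → uv ; (there (there m)) → sub m }
  ; inside = (v∈ , v∈) ∷ (insert-old v U u u∈ , v∈) ∷ All.map (λ {e} (p , q) → insert-old v U (proj₁ e) p , insert-old v U (proj₂ e) q) inside
  ; ind = attach (new u∈) (All.map (λ p → new (proj₁ p)) inside) (All.map (λ p → new (proj₂ p)) inside) ind
  ; size = trans (cong (λ l → suc (suc l)) size) (trans (cong suc (sym (ℕP.+-suc (card U) (card U)))) (sym (cong₂ ℕ._+_ (card-insert v U v∉) (card-insert v U v∉))))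
  ; root = root
  ; root∈ = insert-old v U root root∈
  }
  where
  open Grown g
  v∈ = VecP.lookup∘updateAt v U
  new : ∀ {i} → lookup U i ≡ true → i ≢ v
  new p refl = contradiction (trans (sym p) v∉) λ ()

crossing : ∀ (G : SimpleGraph n) U {i j} → Star (Edge G) i j → lookup U i ≡ true → lookup U j ≡ false →
           ∃₂ λ u v → lookup U u ≡ true × lookup U v ≡ false × Edge G u v
crossing G U ε                    p q = contradiction (trans (sym p) q) λ ()
crossing G U (_◅_ {i} {k} e path) p q with lookup U k in eq
... | true  = crossing G U path eq q
... | false = i , k , p , eq , e

loop : ∀ (G : SimpleGraph n) v → (v , v) ∈ arcs G
loop G v = ∈-arcs G v v (go v)
  where
  go : ∀ v → joined G v v ≡ true
  go v with v Fin.≟ v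
  ... | yes _ = refl
  ... | no ne = contradiction refl ne

edge : ∀ (G : SimpleGraph n) {u v} → Edge G u v → (u , v) ∈ arcs G
edge G {u} {v} e = ∈-arcs G u v (trans (cong (⌊ u Fin.≟ v ⌋ ∨_) e) (BoolP.∨-zeroʳ _))

-- `r` counts the vertices still outside `U`. While one is left, a path to it from the root crosses
-- the boundary of `U`, and the far end of the crossing edge is attached.
spans : ∀ (G : SimpleGraph n) → Connected G → ∀ r U → card U ℕ.+ r ≡ n → Grown (arcs G) U → Grown (arcs G) ⊤
spans {n} G conn r U total g with FinP.any? (λ i → lookup U i BoolP.≟ false)
... | no all = subst (Grown (arcs G)) (vec-ext λ i → trans (BoolP.¬-not (λ eq → all (i , eq))) (sym (lookup-⊤ i))) g
... | yes (w , w∉) with crossing G U (conn (Grown.root g) w) (Grown.root∈ g) w∉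
spans {n} G conn zero U total g | yes (w , w∉) | _ =
  contradiction (ℕP.≤-trans (ℕP.≤-reflexive (sym (card-insert w U w∉))) (∣p∣≤n (insert w U)))
    (ℕP.<⇒≱ (s≤s (ℕP.≤-reflexive (trans (sym total) (ℕP.+-identityʳ (card U))))))
spans {n} G conn (suc r) U total g | yes _ | u , v , u∈ , v∉ , e =
  spans G conn r (insert v U) (trans (cong (ℕ._+ r) (card-insert v U v∉)) (trans (sym (ℕP.+-suc (card U) r)) total))
    (grow u v u∈ v∉ (loop G v) (edge G e) g)

seed : ∀ (G : SimpleGraph (suc m)) → Grown (arcs G) ⁅ zero ⁆
seed {m} G = record
  { fs = (zero , zero) ∷ []
  ; sub = λ { (here refl) → loop G zero }
  ; inside = (refl , refl) ∷ []
  ; ind = ind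
  ; size = sym (cong₂ ℕ._+_ (∣⁅x⁆∣≡1 {suc m} zero) (∣⁅x⁆∣≡1 {suc m} zero))
  ; root = zero
  ; root∈ = refl
  }
  where
  ind : Independent {suc m} ((zero , zero) ∷ [])
  ind (a ∷ []) circ = cong (_∷ []) (trans (sym (ℤP.+-identityʳ a))
    (cong Vec.head (proj₁ (circ⇒margins ((zero , zero) ∷ []) {a ∷ []} circ))))

spanning : ∀ (G : SimpleGraph (suc m)) → Connected G →
           Σ (List (Arc (suc m))) λ fs → (∀ {e} → e ∈ fs → e ∈ arcs G) × Independent fs × suc (length fs) ≡ suc m ℕ.+ suc m
spanning {m} G conn = fs , sub , ind , trans size (cong₂ ℕ._+_ (∣⊤∣≡n (suc m)) (∣⊤∣≡n (suc m)))
  where open Grown (spans G conn m ⁅ zero ⁆ (cong (ℕ._+ m) (∣⁅x⁆∣≡1 {suc m} zero)) (seed G))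

theorem2p8 : (N : ℕ) → 1 ≤ N → (G : SimpleGraph N) → Connected G →
    Σ (List (Vec ℕ N)) (λ L → EnumeratesDraconian G L × NVol (PQVerts G) (length L))
theorem2p8 (suc m) _ G conn = dragons (arcs G) ,
  (unique-dragons (arcs G) , λ a → mk⇔
    (λ a∈ → Equivalence.to (dragon⇔draconian G a) (∈-dragons⇒dragon (arcs G) a∈))
    (λ D → dragon⇒∈-dragons (arcs G) (Equivalence.from (dragon⇔draconian G a) D))) ,
  subst (λ V → NVol V (length (dragons (arcs G)))) (sym (vertices≡ G)) (nvol (arcs G) (isDim (arcs G) (spanning G conn)))
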